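{- Let $F$ be the CNF encoding of an unsatisfiable system of $m$ linear equations over a finite field. There is a Cutting Planes refutation of $F$ of size $|F|^{O(\log m)}$.
   Context: A system of linear equations over $\mathbb{F}_q$ has width $d$ if each equation has at most $d$ variables with nonzero coefficient. Each $\mathbb{F}_q$-valued variable is encoded by Boolean variables, and each width-$d$ equation is encoded by $q^{d-1}$ width-$d$ clauses, one ruling out each falsifying assignment; $|F|:=mq^{d-1}$ denotes the size of the resulting CNF. The CNF is translated into linear inequalities in the standard way ($0\le x_i\le1$, and for each clause $\bigvee_{i\in P}x_i\vee\bigvee_{i\in N}\neg x_i$ the inequality $\sum_{i\in P}x_i+\sum_{i\in N}(1-x_i)\ge1$). Cutting Planes: a proof is a sequence of integer linear inequalities, each from the system or derived from earlier ones by nonnegative integer linear combination of two earlier inequalities or by division (from $ax\le b$ with a positive integer $d$ dividing all entries of $a$, deduce $(a/d)x\le\lfloor b/d\rfloor$); a refutation derives $0\ge1$; size = number of lines. -}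

module Defs where

open import Data.Nat as ℕ using (ℕ; zero; suc; _∸_; _^_)
open import Data.Integer as ℤ using (ℤ; +_; _/ℕ_)
open import Data.Integer.Divisibility using (_∣_)
open import Data.Fin using (Fin) renaming (zero to fzero; suc to fsuc)
open import Data.Fin.Properties using () renaming (_≟_ to _≟ᶠ_)
open import Data.List using (List; []; _∷_; length; filter; map; foldr; lookup; _∷ʳ_; [_]; _++_)
open import Data.List.Relation.Unary.Any using (Any)
open import Data.Product using (Σ; _×_; _,_; ∃; ∃-syntax)
open import Data.Product.Properties using (≡-dec)
open import Relation.Nullary using (¬_; Dec; yes; no; ¬?)
open import Relation.Binary.PropositionalEquality using (_≡_; _≢_)
open import Algebra.Structures using (IsCommutativeRing)

-- Finite fields.  A finite field with q elements, with carrier Fin q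
-- (every finite field of order q is isomorphic to one of this form).

record FiniteField (q : ℕ) : Set where
  field
    _+_ _*_ : Fin q → Fin q → Fin q
    -_      : Fin q → Fin q
    0# 1#   : Fin q
    _⁻¹     : Fin q → Fin q
    isCommutativeRing : IsCommutativeRing _≡_ _+_ _*_ -_ 0# 1#
    0≢1     : 0# ≢ 1#
    ⁻¹-inverse : ∀ x → x ≢ 0# → x * (x ⁻¹) ≡ 1#

record Equation (q n : ℕ) : Set where
  constructor mkEq
  field
    coeff : Fin n → Fin q
    rhs   : Fin q

open Equation public

module _ {q : ℕ} (K : FiniteField q) where
  open FiniteField K

  sumFin : ∀ {n} → (Fin n → Fin q) → Fin q
  sumFin {zero}  f = 0#
  sumFin {suc n} f = f fzero + sumFin (λ i → f (fsuc i))

  allFin′ : ∀ n → List (Fin n)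
  allFin′ zero    = []
  allFin′ (suc n) = fzero ∷ map fsuc (allFin′ n)

  support : ∀ {n} → Equation q n → List (Fin n)
  support {n} e = filter (λ i → ¬? (coeff e i ≟ᶠ 0#)) (allFin′ n)

  width : ∀ {n} → Equation q n → ℕ
  width e = length (support e)

  Sat : ∀ {n} → (Fin n → Fin q) → Equation q n → Set
  Sat σ e = sumFin (λ i → coeff e i * σ i) ≡ rhs e

  Satisfiable : ∀ {n m} → (Fin m → Equation q n) → Set
  Satisfiable {n} {m} sys = ∃[ σ ] (∀ j → Sat σ (sys j))

data Literal (V : Set) : Set where
  pos neg : V → Literal V

Clause : Set → Set
Clause V = List (Literal V)

-- Boolean variables of the encoding: y (i , a) means "x_i = a".
BVar : ℕ → ℕ → Set
BVar n q = Fin n × Fin q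

module _ {q : ℕ} (K : FiniteField q) where
  open FiniteField K

  -- Clauses of the CNF encoding F of a system sys (one-hot encoding):
  --  * for each variable i: at least one value  (y_{i,0} ∨ ... ∨ y_{i,q-1})
  --  * for each variable i and values a ≠ b: at most one (¬y_{i,a} ∨ ¬y_{i,b})
  --  * for each equation  c_v x_v + Σ_{u ∈ rest} c_u x_u = b  (support v ∷ rest)
  --    and each assignment σ of the other support variables, the width-k clause
  --      ∨_{u ∈ rest} ¬y_{u,σ u}  ∨  y_{v, c_v⁻¹ (b - Σ_{u∈rest} c_u σ u)}
  --    ruling out the falsifying assignments extending σ (q^{k-1} clauses for
  --    an equation of width k);  an equation 0 = b with b ≠ 0 gives the empty clause.
  eqClause : ∀ {n} → Equation q n → List (Fin n) → (Fin n → Fin q) → Clause (BVar n q)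
  eqClause e [] σ = []
  eqClause e (v ∷ rest) σ =
    pos (v , (coeff e v ⁻¹) * (rhs e + (- foldr (λ u s → (coeff e u * σ u) + s) 0# rest)))
      ∷ map (λ u → neg (u , σ u)) rest

  data InCNF {n m : ℕ} (sys : Fin m → Equation q n) : Clause (BVar n q) → Set where
    atLeastOne : ∀ i → InCNF sys (map (λ a → pos (i , a)) (allFin′ K q))
    atMostOne  : ∀ i a b → a ≢ b → InCNF sys (neg (i , a) ∷ neg (i , b) ∷ [])
    eqnNonEmpty : ∀ j v rest σ → support K (sys j) ≡ v ∷ rest →
                  InCNF sys (eqClause (sys j) (v ∷ rest) σ)
    eqnEmpty   : ∀ j → support K (sys j) ≡ [] → rhs (sys j) ≢ 0# → InCNF sys []

  sizeF : (m d : ℕ) → ℕ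
  sizeF m d = m ℕ.* (q ^ (d ∸ 1))

infix 4 _≤ᵢ_
record Ineq (V : Set) : Set where
  constructor _≤ᵢ_
  field
    lhs   : V → ℤ
    bound : ℤ

open Ineq public

_≐_ : ∀ {V} → Ineq V → Ineq V → Set
I ≐ J = (∀ v → lhs I v ≡ lhs J v) × bound I ≡ bound J

module _ {V : Set} (_≟ᵥ_ : (u v : V) → Dec (u ≡ v)) where

  indicator : V → V → ℤ
  indicator u v with u ≟ᵥ v
  ... | yes _ = + 1
  ... | no  _ = + 0

  -- Clause  ∨_{P} x ∨ ∨_{N} ¬x  ↦  Σ_P x + Σ_N (1 - x) ≥ 1,
  -- written in ≤-form:  Σ_P (-x) + Σ_N x ≤ |N| - 1.
  litCoeff : Literal V → V → ℤ
  litCoeff (pos u) v = ℤ.- indicator u v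
  litCoeff (neg u) v = indicator u v

  negCount : Clause V → ℕ
  negCount []          = 0
  negCount (pos _ ∷ C) = negCount C
  negCount (neg _ ∷ C) = suc (negCount C)

  clauseIneq : Clause V → Ineq V
  clauseIneq C = (λ v → foldr (λ l s → litCoeff l v ℤ.+ s) (+ 0) C)
                 ≤ᵢ (+ negCount C ℤ.- + 1)

  data Axiom (F : Clause V → Set) : Ineq V → Set where
    clauseAx : ∀ C → F C → Axiom F (clauseIneq C)
    upperAx  : ∀ v → Axiom F (indicator v ≤ᵢ + 1)
    lowerAx  : ∀ v → Axiom F ((λ u → ℤ.- indicator v u) ≤ᵢ + 0)

  combine : ℕ → Ineq V → ℕ → Ineq V → Ineq V
  combine c I d J = (λ v → (+ c ℤ.* lhs I v) ℤ.+ (+ d ℤ.* lhs J v))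
                    ≤ᵢ ((+ c ℤ.* bound I) ℤ.+ (+ d ℤ.* bound J))

  divide : ℕ → Ineq V → Ineq V
  divide k I = (λ v → lhs I v /ℕ suc k) ≤ᵢ (bound I /ℕ suc k)

  data Step (F : Clause V → Set) (Γ : List (Ineq V)) (L : Ineq V) : Set where
    axiom : ∀ A → Axiom F A → L ≐ A → Step F Γ L
    comb  : (i j : Fin (length Γ)) (c d : ℕ) →
            L ≐ combine c (lookup Γ i) d (lookup Γ j) → Step F Γ L
    div   : (i : Fin (length Γ)) (k : ℕ) →
            (∀ v → + suc k ∣ lhs (lookup Γ i) v) →
            L ≐ divide k (lookup Γ i) → Step F Γ L

  data Derivation (F : Clause V → Set) : List (Ineq V) → Set where
    []  : Derivation F []
    _▷_ : ∀ {Γ L} → Derivation F Γ → Step F Γ L → Derivation F (Γ ∷ʳ L)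

  falsum : Ineq V
  falsum = (λ _ → + 0) ≤ᵢ ℤ.-[1+ 0 ]

  CPRefutation : (F : Clause V → Set) → ℕ → Set
  CPRefutation F s = ∃[ Γ ] (Derivation F Γ × Any (_≐ falsum) Γ × length Γ ℕ.≤ s)

_≟ᴮ_ : ∀ {n q} → (u v : BVar n q) → Dec (u ≡ v)
_≟ᴮ_ = ≡-dec _≟ᶠ_ _≟ᶠ_

{-
If the system is unsatisfiable, some combination of its equations with coefficients μ j reads 0 = 1.
Let p be the characteristic and φ an additive map from the field to ℤ / p with φ 1 ≠ 0, lifted to
{0, …, p - 1}. The integral form z j = Σ φ (μ j c u a) · y (u , a), over the variables u of equation j
with coefficient c u and all values a, is congruent modulo p to β j = φ (μ j b j) wherever equation j
holds, while the coefficients of Σ_j z j are all divisible by p and Σ_j β j is not.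

For a set S of equations let z S and β S be the sums over S. The claim proved by halving S is: if v is
not congruent to β S, then z S = v is refutable. Write S = S₁ ∪ S₂ and exclude z S₁ = 0, 1, 2, … one
after the other; whenever z S₁ = w, one of z S₁ = w and z S₂ = v - w is incongruent to the respective
β. As there are polynomially many values w and the depth of the recursion is log m, the size is
quasipolynomial. For one equation all q^d assignments are checked and then resolved away. Finally
Σ_j z j is a multiple of p by rounding, so all its values are excluded.

Hypothetical reasoning is avoided by carrying an error term: z S = v is replaced by a form h with
h ≥ ∣ z S - v ∣, and its refutation by a derivation of h ≥ 1.
-}
module Submission where

open import Defs
open import Data.Nat as ℕ using (ℕ; zero; suc; z≤n; s≤s; _∸_; _^_; _≤_)
import Data.Nat.Properties as ℕ
open import Data.Nat.Divisibility as ℕ∣ using (_∣_; divides)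
import Data.Nat.DivMod as ℕ
open import Data.Nat.Coprimality using (Coprime; coprime-Bézout)
open import Data.Nat.GCD using (module Bézout)
open import Data.Nat.Induction using (<-rec)
open import Data.Nat.Logarithm using (⌊log₂_⌋; ⌊log₂⌋-mono-≤; ⌊log₂[2^n]⌋≡n)
import Data.Nat.Tactic.RingSolver as ℕSolver
import Data.Integer as ℤ
import Data.Integer.Properties as ℤ
import Data.Integer.DivMod as ℤ
open import Data.Integer.Divisibility.Signed as ℤ∣ using () renaming (_∣_ to _∣ℤ_; _∣?_ to _∣ℤ?_)
open import Data.Integer.Tactic.RingSolver using (solve-∀)
open import Data.Bool using (T; if_then_else_)
open import Data.Fin using (Fin; toℕ; fromℕ<) renaming (zero to fzero; suc to fsuc)
open import Data.Fin.Properties using (any?; ¬∀⟶∃¬; pigeonhole; toℕ<n; toℕ-fromℕ<; suc-injective) renaming (_≟_ to _≟ᶠ_)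
open import Data.List using (List; []; _∷_; foldr; map; filter; length; lookup; _++_; take; drop)
import Data.List.Properties as List
open import Data.List.Relation.Unary.Any as Any using (Any; here; there)
open import Data.List.Relation.Unary.Any.Properties using (++⁺ˡ; ++⁺ʳ; lookup-index)
open import Data.List.Relation.Unary.All as All using (All; []; _∷_)
import Data.List.Relation.Unary.All.Properties as All
open import Data.List.Relation.Unary.AllPairs using ([]; _∷_)
open import Data.List.Relation.Unary.Unique.Propositional using (Unique)
import Data.List.Relation.Unary.Unique.Propositional.Properties as Unique
open import Data.List.Membership.Propositional using (_∈_)
open import Data.List.Membership.Propositional.Properties using (∈-map⁺; ∈-filter⁺)
open import Data.Maybe using (Maybe; just; nothing)
open import Data.Product using (Σ; _×_; _,_; ∃; ∃-syntax; proj₁; proj₂)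
open import Data.Sum using (_⊎_; inj₁; inj₂)
open import Data.Empty using (⊥-elim)
open import Data.Vec.Functional using () renaming (_∷_ to _◂_)
open import Function using (_∘_)
open import Level using (0ℓ)
open import Relation.Nullary using (¬_; Dec; yes; no; ¬?; does; contradiction)
open import Relation.Nullary.Decidable using (map′; decidable-stable; _×-dec_)
open import Relation.Binary.PropositionalEquality
open import Algebra.Bundles using (CommutativeRing)
import Algebra.Properties.Ring as RingProperties
import Algebra.Properties.Semiring.Sum as SemiringSum
import Algebra.Properties.Semiring.Mult as SemiringMult

∈-allFin′ : ∀ {q} (K : FiniteField q) {n} (i : Fin n) → i ∈ allFin′ K n
∈-allFin′ K fzero    = here refl
∈-allFin′ K (fsuc i) = there (∈-map⁺ fsuc (∈-allFin′ K i))

least : ∀ {P : ℕ → Set} → (∀ k → Dec (P k)) → ∀ n → P n →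
        ∃[ k ] k ℕ.≤ n × P k × (∀ {j} → j ℕ.< k → ¬ P j)
least {P} P? = <-rec _ go
  where
  go : ∀ n → (∀ {k} → k ℕ.< n → P k → ∃[ i ] i ℕ.≤ k × P i × (∀ {j} → j ℕ.< i → ¬ P j)) →
       P n → ∃[ k ] k ℕ.≤ n × P k × (∀ {j} → j ℕ.< k → ¬ P j)
  go n rec Pn with ℕ.anyUpTo? P? n
  ... | no none = n , ℕ.≤-refl , Pn , λ j<n Pj → none (_ , j<n , Pj)
  ... | yes (k , k<n , Pk) with rec k<n Pk
  ... | i , i≤k , rest = i , ℕ.≤-trans i≤k (ℕ.<⇒≤ k<n) , rest

-- Linear algebra over the field: Fredholm's alternative by Gaussian elimination.

module LinearAlgebra {q : ℕ} (K : FiniteField q) where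

  open FiniteField K using (0#; 1#; _⁻¹; isCommutativeRing; 0≢1; ⁻¹-inverse)

  R : CommutativeRing 0ℓ 0ℓ
  R = record { isCommutativeRing = isCommutativeRing }

  open CommutativeRing R public
    using (_+_; _*_; -_; +-assoc; +-comm; +-identityˡ; +-identityʳ; *-assoc; *-comm; *-identityˡ; *-identityʳ;
           distribˡ; distribʳ; zeroˡ; zeroʳ; -‿inverseˡ; -‿inverseʳ; semiring; ring)
  open RingProperties ring public
    using (-‿distribˡ-*; -‿distribʳ-*; -‿involutive; -0#≈0#; +-cancelˡ)
  open SemiringSum semiring public
    using (sum; sum-cong-≗; ∑-distrib-+; *-distribˡ-sum; *-distribʳ-sum)
  open SemiringMult semiring public
    using (×-homo-+; ×-assocˡ; ×1-homo-*; ×-assoc-*)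
    renaming (_×_ to infixr 8 _•_)
  open ≡-Reasoning

  sumFin≡sum : ∀ {n} (f : Fin n → Fin q) → sumFin K f ≡ sum f
  sumFin≡sum {zero}  f = refl
  sumFin≡sum {suc n} f = cong (f fzero +_) (sumFin≡sum (f ∘ fsuc))

  -- This is the value that an equation `c x + s = b` forces on `x`; `eqClause` asserts it once the
  -- other variables are fixed.
  solve-for : ∀ {c} b s → c ≢ 0# → c * ((c ⁻¹) * (b + (- s))) + s ≡ b
  solve-for {c} b s c≢0 = begin
    c * ((c ⁻¹) * (b + (- s))) + s   ≡⟨ cong (_+ s) (sym (*-assoc c (c ⁻¹) _)) ⟩
    c * (c ⁻¹) * (b + (- s)) + s     ≡⟨ cong (λ x → x * (b + (- s)) + s) (⁻¹-inverse c c≢0) ⟩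
    1# * (b + (- s)) + s             ≡⟨ cong (_+ s) (*-identityˡ _) ⟩
    b + (- s) + s                    ≡⟨ +-assoc b (- s) s ⟩
    b + ((- s) + s)                  ≡⟨ trans (cong (b +_) (-‿inverseˡ s)) (+-identityʳ b) ⟩
    b                                ∎

  sumFin-allFin′ : ∀ {n} (f : Fin n → Fin q) → sumFin K f ≡ foldr (λ u s → f u + s) 0# (allFin′ K n)
  sumFin-allFin′ {zero}  f = refl
  sumFin-allFin′ {suc n} f = cong (f fzero +_) (trans (sumFin-allFin′ (f ∘ fsuc))
    (sym (List.foldr-map (λ u s → f u + s) fsuc 0# (allFin′ K n))))

  support-nonzero : ∀ {n} (e : Equation q n) → All (λ u → coeff e u ≢ 0#) (support K e)
  support-nonzero {n} e = All.all-filter (λ u → ¬? (coeff e u ≟ᶠ 0#)) (allFin′ K n)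

  -- Links `Sat`, which sums over all variables, with the clauses and the integral forms, which see
  -- only the support.
  sum-support : ∀ {n} (e : Equation q n) (σ : Fin n → Fin q) →
    sumFin K (λ u → coeff e u * σ u) ≡ foldr (λ u s → coeff e u * σ u + s) 0# (support K e)
  sum-support {n} e σ = trans (sumFin-allFin′ (λ u → coeff e u * σ u)) (drop-zeros (allFin′ K n))
    where
    drop-zeros : ∀ us → foldr (λ u s → coeff e u * σ u + s) 0# us ≡
      foldr (λ u s → coeff e u * σ u + s) 0# (filter (λ u → ¬? (coeff e u ≟ᶠ 0#)) us)
    drop-zeros [] = refl
    drop-zeros (u ∷ us) with coeff e u ≟ᶠ 0#
    ... | no  _    = cong (coeff e u * σ u +_) (drop-zeros us)
    ... | yes cu≡0 = trans (cong₂ _+_ (trans (cong (_* σ u) cu≡0) (zeroˡ (σ u))) (drop-zeros us)) (+-identityˡ _)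

  sum-zero : ∀ {n} {f : Fin n → Fin q} → (∀ i → f i ≡ 0#) → sum f ≡ 0#
  sum-zero {zero}  f≡0 = refl
  sum-zero {suc n} f≡0 = trans (cong₂ _+_ (f≡0 fzero) (sum-zero (f≡0 ∘ fsuc))) (+-identityˡ 0#)

  single : ∀ {m} → Fin m → Fin q → Fin m → Fin q
  single fzero    s fzero    = s
  single fzero    s (fsuc j) = 0#
  single (fsuc p) s fzero    = 0#
  single (fsuc p) s (fsuc j) = single p s j

  sum-single : ∀ {m} (p : Fin m) s (f : Fin m → Fin q) → sum (λ j → single p s j * f j) ≡ s * f p
  sum-single fzero s f = trans (cong (s * f fzero +_) (sum-zero λ j → zeroˡ (f (fsuc j)))) (+-identityʳ _)
  sum-single (fsuc p) s f = begin
    0# * f fzero + sum (λ j → single p s j * f (fsuc j)) ≡⟨ cong₂ _+_ (zeroˡ _) (sum-single p s (f ∘ fsuc)) ⟩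
    0# + s * f (fsuc p)                                  ≡⟨ +-identityˡ _ ⟩
    s * f (fsuc p)                                       ∎

  ⁻¹-inverseˡ : ∀ x → x ≢ 0# → (x ⁻¹) * x ≡ 1#
  ⁻¹-inverseˡ x x≢0 = trans (*-comm _ x) (⁻¹-inverse x x≢0)

  x+[-x+y]≡y : ∀ x y → x + ((- x) + y) ≡ y
  x+[-x+y]≡y x y = trans (sym (+-assoc x (- x) y)) (trans (cong (_+ y) (-‿inverseʳ x)) (+-identityˡ y))

  sum-mul-add : ∀ {m} (f g : Fin m → Fin q) (h : Fin m → Fin q) z →
                sum (λ j → h j * (f j + g j * z)) ≡ sum (λ j → h j * f j) + sum (λ j → h j * g j) * z
  sum-mul-add f g h z = begin
    sum (λ j → h j * (f j + g j * z))
        ≡⟨ sum-cong-≗ (λ j → trans (distribˡ (h j) _ _) (cong (h j * f j +_) (sym (*-assoc _ _ _)))) ⟩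
    sum (λ j → h j * f j + h j * g j * z)                 ≡⟨ ∑-distrib-+ (λ j → h j * f j) (λ j → h j * g j * z) ⟩
    sum (λ j → h j * f j) + sum (λ j → h j * g j * z)     ≡⟨ cong (_ +_) (sym (*-distribʳ-sum z (λ j → h j * g j))) ⟩
    sum (λ j → h j * f j) + sum (λ j → h j * g j) * z     ∎

  Solution : ∀ {n m} → (Fin m → Fin n → Fin q) → (Fin m → Fin q) → Set
  Solution {n} A b = Σ (Fin n → Fin q) λ σ → ∀ j → sum (λ u → A j u * σ u) ≡ b j

  Refuter : ∀ {n m} → (Fin m → Fin n → Fin q) → (Fin m → Fin q) → Set
  Refuter {m = m} A b = Σ (Fin m → Fin q) λ μ → (∀ u → sum (λ j → μ j * A j u) ≡ 0#) × sum (λ j → μ j * b j) ≡ 1#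

  module Eliminate {n m} (A : Fin m → Fin (suc n) → Fin q) (b : Fin m → Fin q)
                   (p : Fin m) (pivot≢0 : A p fzero ≢ 0#) where

    t nt : Fin m → Fin q
    t j  = A j fzero * (A p fzero ⁻¹)
    nt j = - t j

    -- The pivot row is reduced as well and turns into 0 = 0, so the number of equations stays `m`
    -- and the rows keep their indices.
    reduce : (Fin m → Fin q) → Fin m → Fin q
    reduce f j = f j + nt j * f p

    A′ : Fin m → Fin n → Fin q
    A′ j u = reduce (λ i → A i (fsuc u)) j

    t-pivot : ∀ j → t j * A p fzero ≡ A j fzero
    t-pivot j = trans (*-assoc _ _ _) (trans (cong (A j fzero *_) (⁻¹-inverseˡ _ pivot≢0)) (*-identityʳ _))

    reduce-pivot : ∀ j → reduce (λ i → A i fzero) j ≡ 0#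
    reduce-pivot j = begin
      A j fzero + nt j * A p fzero     ≡⟨ cong (A j fzero +_) (sym (-‿distribˡ-* _ _)) ⟩
      A j fzero + (- (t j * A p fzero)) ≡⟨ cong (λ x → A j fzero + (- x)) (t-pivot j) ⟩
      A j fzero + (- A j fzero)        ≡⟨ -‿inverseʳ _ ⟩
      0#                               ∎

    -- The new variable is solved from the pivot equation; every other equation differs from its
    -- reduced form by a multiple of that one.
    liftSolution : Solution A′ (reduce b) → Solution A b
    liftSolution (σ , sat) = ((A p fzero ⁻¹) * (b p + (- rem p))) ◂ σ , λ j → begin
      A j fzero * ((A p fzero ⁻¹) * (b p + (- rem p))) + rem j ≡⟨ cong (_+ rem j) (sym (*-assoc _ _ _)) ⟩
      t j * (b p + (- rem p)) + rem j              ≡⟨ cong (_+ rem j) (distribˡ _ _ _) ⟩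
      t j * b p + t j * (- rem p) + rem j          ≡⟨ cong (λ x → t j * b p + x + rem j)
          (trans (sym (-‿distribʳ-* _ _)) (-‿distribˡ-* _ _)) ⟩
      t j * b p + nt j * rem p + rem j             ≡⟨ +-assoc _ _ _ ⟩
      t j * b p + (nt j * rem p + rem j)           ≡⟨ cong (t j * b p +_) (trans (+-comm _ _) (rem-reduce j)) ⟩
      t j * b p + (b j + nt j * b p)               ≡⟨ cong (t j * b p +_)
          (trans (+-comm _ _) (cong (_+ b j) (sym (-‿distribˡ-* _ _)))) ⟩
      t j * b p + ((- (t j * b p)) + b j)          ≡⟨ x+[-x+y]≡y _ _ ⟩
      b j                                          ∎
      where
      rem : Fin m → Fin q
      rem j = sum (λ u → A j (fsuc u) * σ u)
      rem-reduce : ∀ j → rem j + nt j * rem p ≡ b j + nt j * b p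
      rem-reduce j = begin
        rem j + nt j * rem p ≡⟨ cong (rem j +_) (*-distribˡ-sum (nt j) (λ u → A p (fsuc u) * σ u)) ⟩
        rem j + sum (λ u → nt j * (A p (fsuc u) * σ u))
            ≡⟨ sym (∑-distrib-+ (λ u → A j (fsuc u) * σ u) (λ u → nt j * (A p (fsuc u) * σ u))) ⟩
        sum (λ u → A j (fsuc u) * σ u + nt j * (A p (fsuc u) * σ u))
          ≡⟨ sum-cong-≗ (λ u → trans (cong (A j (fsuc u) * σ u +_) (sym (*-assoc _ _ _))) (sym (distribʳ _ _ _))) ⟩
        sum (λ u → A′ j u * σ u) ≡⟨ sat j ⟩
        b j + nt j * b p ∎

    -- Row operations are transposed: combining the reduced rows with `μ` amounts to combining the
    -- original rows with `ν`, where the pivot row collects the weight `s` of all its subtracted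
    -- copies.
    liftRefuter : Refuter A′ (reduce b) → Refuter A b
    liftRefuter (μ , kills , one) = ν , kills′ , trans (transfer b) one
      where
      s : Fin q
      s = sum (λ j → μ j * nt j)
      ν : Fin m → Fin q
      ν j = μ j + single p s j
      transfer : ∀ f → sum (λ j → ν j * f j) ≡ sum (λ j → μ j * reduce f j)
      transfer f = begin
        sum (λ j → ν j * f j)
            ≡⟨ sum-cong-≗ (λ j → distribʳ (f j) (μ j) (single p s j)) ⟩
        sum (λ j → μ j * f j + single p s j * f j)
            ≡⟨ ∑-distrib-+ (λ j → μ j * f j) (λ j → single p s j * f j) ⟩
        sum (λ j → μ j * f j) + sum (λ j → single p s j * f j)     ≡⟨ cong (_ +_) (sum-single p s f) ⟩
        sum (λ j → μ j * f j) + s * f p                            ≡⟨ sym (sum-mul-add f nt μ (f p)) ⟩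
        sum (λ j → μ j * reduce f j)                               ∎
      kills′ : ∀ u → sum (λ j → ν j * A j u) ≡ 0#
      kills′ fzero    = trans (transfer _) (sum-zero λ j → trans (cong (μ j *_) (reduce-pivot j)) (zeroʳ _))
      kills′ (fsuc u) = trans (transfer _) (kills u)

  -- Induction on the number of variables. Without variables each equation reads `0 = b j`: either
  -- all of them hold, or one nonzero right-hand side, scaled by its inverse, is a refuter.
  fredholm : ∀ n {m} (A : Fin m → Fin n → Fin q) (b : Fin m → Fin q) → Solution A b ⊎ Refuter A b
  fredholm zero A b with any? (λ j → ¬? (b j ≟ᶠ 0#))
  ... | yes (j , bj≢0) = inj₂ (single j (b j ⁻¹) , (λ ()) , trans (sum-single j _ b) (⁻¹-inverseˡ _ bj≢0))
  ... | no  b≡0 = inj₁ ((λ ()) , λ j → sym (decidable-stable (b j ≟ᶠ 0#) (λ bj≢0 → b≡0 (j , bj≢0))))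
  fredholm (suc n) A b with any? (λ j → ¬? (A j fzero ≟ᶠ 0#))
  ... | yes (p , pivot≢0) with fredholm n (Eliminate.A′ A b p pivot≢0) (Eliminate.reduce A b p pivot≢0 b)
  ...   | inj₁ sol = inj₁ (Eliminate.liftSolution A b p pivot≢0 sol)
  ...   | inj₂ ref = inj₂ (Eliminate.liftRefuter A b p pivot≢0 ref)
  -- The first column is zero, so this variable is free and receives the value `0#`.
  fredholm (suc n) A b | no noPivot with fredholm n (λ j u → A j (fsuc u)) b
  ...   | inj₁ (σ , sat) = inj₁ (0# ◂ σ , λ j → trans (cong₂ _+_ (zeroʳ _) (sat j)) (+-identityˡ _))
  ...   | inj₂ (μ , kills , one) = inj₂ (μ , kills′ , one)
    where
    kills′ : ∀ u → sum (λ j → μ j * A j u) ≡ 0#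
    kills′ fzero = sum-zero λ j →
      trans (cong (μ j *_) (decidable-stable (A j fzero ≟ᶠ 0#) (λ ≢0 → noPivot (j , ≢0)))) (zeroʳ _)
    kills′ (fsuc u) = kills u

  -- The characteristic of the field and inverses modulo it.

  noZeroDivisors : ∀ x y → x * y ≡ 0# → x ≡ 0# ⊎ y ≡ 0#
  noZeroDivisors x y xy≡0 with x ≟ᶠ 0#
  ... | yes x≡0 = inj₁ x≡0
  ... | no  x≢0 = inj₂ (begin
    y                ≡⟨ sym (*-identityˡ y) ⟩
    1# * y           ≡⟨ cong (_* y) (sym (⁻¹-inverseˡ x x≢0)) ⟩
    (x ⁻¹) * x * y   ≡⟨ *-assoc _ _ _ ⟩
    (x ⁻¹) * (x * y) ≡⟨ cong ((x ⁻¹) *_) xy≡0 ⟩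
    (x ⁻¹) * 0#      ≡⟨ zeroʳ _ ⟩
    0#               ∎)

  -- Two of the `q + 1` multiples `0 • 1#`, ..., `q • 1#` coincide; subtracting them leaves a
  -- positive multiple that vanishes. The bound on `k` later yields `p ≤ q`.
  someMultiple : ∃[ k ] k ℕ.< q × suc k • 1# ≡ 0#
  someMultiple with pigeonhole (ℕ.n<1+n q) (λ i → toℕ i • 1#)
  ... | i , j , i<j , eq with ℕ.m<n⇒0<n∸m i<j | ℕ.m∸n≤m (toℕ j) (toℕ i) | cong (_• 1#) (ℕ.m+[n∸m]≡n (ℕ.<⇒≤ i<j))
  ... | 0<d | d≤j | split with toℕ j ℕ.∸ toℕ i
  ... | suc k = k , ℕ.≤-trans d≤j (ℕ.s≤s⁻¹ (toℕ<n j)) , +-cancelˡ (toℕ i • 1#) _ _ (begin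
    toℕ i • 1# + suc k • 1#  ≡⟨ sym (×-homo-+ 1# (toℕ i) (suc k)) ⟩
    (toℕ i ℕ.+ suc k) • 1#   ≡⟨ split ⟩
    toℕ j • 1#               ≡⟨ sym eq ⟩
    toℕ i • 1#               ≡⟨ sym (+-identityʳ _) ⟩
    toℕ i • 1# + 0#          ∎)

  abstract
    leastMultiple : ∃[ k ] k ℕ.≤ proj₁ someMultiple × suc k • 1# ≡ 0# × (∀ {j} → j ℕ.< k → ¬ suc j • 1# ≡ 0#)
    leastMultiple = least (λ k → suc k • 1# ≟ᶠ 0#) (proj₁ someMultiple) (proj₂ (proj₂ someMultiple))

  -- The characteristic, given through its predecessor: `p-1 • x` is `- x`, so differences can be
  -- expressed with natural multiples.
  p-1 p : ℕ
  p-1 = proj₁ leastMultiple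
  p = suc p-1

  p≤q : p ℕ.≤ q
  p≤q = ℕ.≤-trans (s≤s (proj₁ (proj₂ leastMultiple))) (proj₁ (proj₂ someMultiple))

  p•1≡0 : p • 1# ≡ 0#
  p•1≡0 = proj₁ (proj₂ (proj₂ leastMultiple))

  p-minimal : ∀ k → suc k • 1# ≡ 0# → p ℕ.≤ suc k
  p-minimal k eq = ℕ.≮⇒≥ λ k<p → proj₂ (proj₂ (proj₂ leastMultiple)) (ℕ.s≤s⁻¹ k<p) eq

  •-as-* : ∀ t x → t • x ≡ (t • 1#) * x
  •-as-* t x = sym (trans (×-assoc-* t 1# x) (cong (t •_) (*-identityˡ x)))

  p∣⇒•1≡0 : ∀ {t} → p ∣ t → t • 1# ≡ 0#
  p∣⇒•1≡0 (divides k refl) = trans (×1-homo-* k p) (trans (cong ((k • 1#) *_) p•1≡0) (zeroʳ _))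

  p∣⇒•≡0 : ∀ {t} → p ∣ t → ∀ x → t • x ≡ 0#
  p∣⇒•≡0 {t} p∣t x = trans (•-as-* t x) (trans (cong (_* x) (p∣⇒•1≡0 p∣t)) (zeroˡ x))

  p-1•x≡-x : ∀ x → p-1 • x ≡ - x
  p-1•x≡-x x = +-cancelˡ x _ _ (trans (p∣⇒•≡0 ℕ∣.∣-refl x) (sym (-‿inverseʳ x)))

  -- If `p = e d`, then `e • 1#` or `d • 1#` vanishes, as there are no zero divisors. Minimality of
  -- `p` leaves `d = 1` or `d = p`, and the latter does not divide `k`.
  coprime-p : ∀ k → ¬ p ∣ k → Coprime k p
  coprime-p k p∤k {d} (d∣k , divides e p≡ed)
    with noZeroDivisors (e • 1#) (d • 1#) (trans (sym (×1-homo-* e d)) (trans (cong (_• 1#) (sym p≡ed)) p•1≡0))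
  coprime-p k p∤k {d} (d∣k , divides zero ()) | _
  coprime-p k p∤k {zero} (d∣k , divides e p≡ed) | _ = contradiction (trans p≡ed (ℕ.*-zeroʳ e)) λ ()
  coprime-p k p∤k {d@(suc d′)} (d∣k , divides e@(suc e′) p≡ed) | inj₁ e•1≡0 =
    ℕ.*-cancelˡ-≡ d 1 e (trans (sym p≡ed) (trans (ℕ.≤-antisym (p-minimal e′ e•1≡0)
        (subst (e ℕ.≤_) (sym p≡ed) (ℕ.m≤m*n e d))) (sym (ℕ.*-identityʳ e))))
  coprime-p k p∤k {d@(suc d′)} (d∣k , divides e@(suc e′) p≡ed) | inj₂ d•1≡0 =
    contradiction (subst (_∣ k) (ℕ.≤-antisym (subst (d ℕ.≤_) (sym p≡ed) (ℕ.m≤n*m d e)) (p-minimal d′ d•1≡0)) d∣k) p∤k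

  inverse-mod-p : ∀ k → ¬ p ∣ k → ∃[ k′ ] (k′ ℕ.* k) • 1# ≡ 1#
  inverse-mod-p k p∤k with coprime-Bézout (coprime-p k p∤k)
  ... | Bézout.+- x y eq = x , trans (cong (_• 1#) (sym eq))
          (trans (cong (1# +_) (p∣⇒•1≡0 (ℕ∣.n∣m*n y))) (+-identityʳ 1#))
  -- Here `x k` is `-1` modulo `p`; the factor `p-1` corrects the sign.
  ... | Bézout.-+ x y eq = p-1 ℕ.* x , (begin
    (p-1 ℕ.* x ℕ.* k) • 1#   ≡⟨ cong (_• 1#) (ℕ.*-assoc p-1 x k) ⟩
    (p-1 ℕ.* (x ℕ.* k)) • 1# ≡⟨ sym (×-assocˡ 1# p-1 _) ⟩
    p-1 • ((x ℕ.* k) • 1#)   ≡⟨ p-1•x≡-x _ ⟩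
    - ((x ℕ.* k) • 1#)       ≡⟨ sym (+-identityˡ _) ⟩
    0# + (- z)               ≡⟨ cong (_+ (- z)) (sym (trans (cong (_• 1#) eq) (p∣⇒•1≡0 (ℕ∣.n∣m*n y)))) ⟩
    1# + z + (- z)           ≡⟨ trans (+-assoc _ _ _) (cong (1# +_) (-‿inverseʳ z)) ⟩
    1# + 0#                  ≡⟨ +-identityʳ 1# ⟩
    1#                       ∎)
    where z = (x ℕ.* k) • 1#

  -- An additive map from the field to ℤ / p that does not vanish at 1#

  record Subgroup : Set₁ where
    field
      Mem : Fin q → Set
      mem? : ∀ x → Dec (Mem x)
      0∈ : Mem 0#
      +∈ : ∀ {x y} → Mem x → Mem y → Mem (x + y)

    •∈ : ∀ t {x} → Mem x → Mem (t • x)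
    •∈ zero    x∈ = 0∈
    •∈ (suc t) x∈ = +∈ x∈ (•∈ t x∈)

    -∈ : ∀ {x} → Mem x → Mem (- x)
    -∈ {x} x∈ = subst Mem (p-1•x≡-x x) (•∈ p-1 x∈)

  open Subgroup

  •-% : ∀ t x → (t ℕ.% p) • x ≡ t • x
  •-% t x = sym (begin
    t • x                                       ≡⟨ cong (_• x) (ℕ.m≡m%n+[m/n]*n t p) ⟩
    (t ℕ.% p ℕ.+ t ℕ./ p ℕ.* p) • x             ≡⟨ ×-homo-+ x (t ℕ.% p) _ ⟩
    (t ℕ.% p) • x + (t ℕ./ p ℕ.* p) • x         ≡⟨ cong ((t ℕ.% p) • x +_) (p∣⇒•≡0 (ℕ∣.n∣m*n (t ℕ./ p)) x) ⟩
    (t ℕ.% p) • x + 0#                          ≡⟨ +-identityʳ _ ⟩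
    (t ℕ.% p) • x                               ∎)

  +-interchange : ∀ a b c d → (a + b) + (c + d) ≡ (a + c) + (b + d)
  +-interchange a b c d = begin
    (a + b) + (c + d) ≡⟨ +-assoc a b _ ⟩
    a + (b + (c + d)) ≡⟨ cong (a +_) (trans (sym (+-assoc b c d)) (trans (cong (_+ d) (+-comm b c)) (+-assoc c b d))) ⟩
    a + (c + (b + d)) ≡⟨ sym (+-assoc a c _) ⟩
    (a + c) + (b + d) ∎

  -- The subgroup generated by `H` and `x`, since `- (t • x)` runs through all multiples of `x`.
  -- Only the finitely many `t` below `p` have to be tried, which makes membership decidable.
  adjoin : Subgroup → Fin q → Subgroup
  adjoin H x = record
    { Mem  = λ y → ∃[ t ] Mem H (y + t • x)
    ; mem? = λ y → map′ (λ (t , y+tx∈) → toℕ t , y+tx∈) (λ (t , y+tx∈) → fromℕ< (ℕ.m%n<n t p) ,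
               subst (λ z → Mem H (y + z)) (trans (sym (•-% t x)) (cong (_• x) (sym (toℕ-fromℕ< (ℕ.m%n<n t p))))) y+tx∈)
               (any? {n = p} λ t → mem? H (y + toℕ t • x))
    ; 0∈   = 0 , subst (Mem H) (sym (+-identityˡ 0#)) (0∈ H)
    ; +∈   = λ {y} {z} (t , y+tx∈) (s , z+sx∈) → t ℕ.+ s ,
               subst (Mem H) (trans (+-interchange y (t • x) z (s • x)) (cong (_ +_) (sym (×-homo-+ x t s))))
                   (+∈ H y+tx∈ z+sx∈)
    }

  Saturated : Subgroup → Fin q → Set
  Saturated H x = Mem H x ⊎ Mem (adjoin H x) 1#

  -- Greedy choice: `x` is adjoined unless this brings in `1#`. Such an obstruction survives every
  -- later enlargement, so a single pass over the list suffices.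
  saturate : (H : Subgroup) → ¬ Mem H 1# → (xs : List (Fin q)) →
             ∃[ H′ ] ¬ Mem H′ 1# × (∀ {y} → Mem H y → Mem H′ y) × (∀ {x} → x ∈ xs → Saturated H′ x)
  saturate H 1∉ [] = H , 1∉ , (λ y∈ → y∈) , λ ()
  saturate H 1∉ (x ∷ xs) with mem? (adjoin H x) 1#
  ... | yes (t , 1+tx∈) with saturate H 1∉ xs
  ...   | H′ , 1∉′ , H⊆H′ , sat = H′ , 1∉′ , H⊆H′ , λ where
            (here refl) → inj₂ (t , H⊆H′ 1+tx∈)
            (there x∈)  → sat x∈
  saturate H 1∉ (x ∷ xs) | no 1∉adj with saturate (adjoin H x) 1∉adj xs
  ...   | H′ , 1∉′ , H⊆H′ , sat = H′ , 1∉′ ,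
            (λ {y} y∈ → H⊆H′ (0 , subst (Mem H) (sym (+-identityʳ y)) y∈)) , λ where
              (here refl) → inj₁ (H⊆H′ (p-1 , subst (Mem H)
                  (sym (trans (cong (x +_) (p-1•x≡-x x)) (-‿inverseʳ x))) (0∈ H)))
              (there x∈)  → sat x∈

  trivial : Subgroup
  trivial = record
    { Mem  = _≡ 0# ; mem? = _≟ᶠ 0# ; 0∈ = refl
    ; +∈   = λ { refl refl → +-identityˡ 0# } }

  abstract
    maximal : ∃[ H ] ¬ Mem H 1# × (∀ {y} → y ≡ 0# → Mem H y) × (∀ {x} → x ∈ allFin′ K q → Saturated H x)
    maximal = saturate trivial (0≢1 ∘ sym) (allFin′ K q)

  -- A maximal additive subgroup avoiding 1#; the multiples of 1# are a complement of it.
  H : Subgroup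
  H = proj₁ maximal

  1∉H : ¬ Mem H 1#
  1∉H = proj₁ (proj₂ maximal)

  -- Congruence of `x` and `t • 1#` modulo `H`: the number `t` represents the image of `x` in the
  -- quotient of the field by `H`, a copy of ℤ / p.
  _~_ : Fin q → ℕ → Set
  x ~ t = Mem H (x + (- (t • 1#)))

  -- For `t` not divisible by `p`, an inverse of `t` modulo `p` would bring `1#` into `H`.
  H-multiples : ∀ t → Mem H (t • 1#) → p ∣ t
  H-multiples t t∈ with p ℕ∣.∣? t
  ... | yes p∣t = p∣t
  ... | no  p∤t with inverse-mod-p t p∤t
  ...   | t′ , t′t≡1 = contradiction (subst (Mem H) (trans (×-assocˡ 1# t′ t) t′t≡1) (•∈ H t′ t∈)) 1∉H

  -- By maximality an `x` outside `H` has `1# + s • x` in `H` for some `s`. This `s` is invertible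
  -- modulo `p`, as `1#` is not in `H`; multiplying by the inverse `s′` shows that `x` is congruent
  -- to `- (s′ • 1#)`.
  residue : ∀ x → ∃[ t ] x ~ t
  residue x with proj₂ (proj₂ (proj₂ maximal)) (∈-allFin′ K x)
  ... | inj₁ x∈ = 0 , subst (Mem H) (sym (trans (cong (x +_) -0#≈0#) (+-identityʳ x))) x∈
  ... | inj₂ (s , 1+sx∈) with p ℕ∣.∣? s
  ...   | yes p∣s = contradiction (subst (Mem H) (trans (cong (1# +_) (p∣⇒•≡0 p∣s x)) (+-identityʳ 1#)) 1+sx∈) 1∉H
  ...   | no  p∤s with inverse-mod-p s p∤s
  ...     | s′ , s′s≡1 = p-1 ℕ.* s′ , subst (Mem H) eq (•∈ H s′ 1+sx∈)
    where
    •-+ : ∀ t y z → t • (y + z) ≡ t • y + t • z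
    •-+ t y z = trans (•-as-* t _) (trans (distribˡ _ _ _) (sym (cong₂ _+_ (•-as-* t y) (•-as-* t z))))
    eq : s′ • (1# + s • x) ≡ x + (- ((p-1 ℕ.* s′) • 1#))
    eq = begin
      s′ • (1# + s • x)             ≡⟨ •-+ s′ _ _ ⟩
      s′ • 1# + s′ • (s • x)        ≡⟨ +-comm _ _ ⟩
      s′ • (s • x) + s′ • 1#        ≡⟨ cong₂ _+_ (trans (×-assocˡ x s′ s)
          (trans (•-as-* (s′ ℕ.* s) x) (trans (cong (_* x) s′s≡1) (*-identityˡ x))))
                                         (sym (-‿involutive _)) ⟩
      x + (- (- (s′ • 1#)))         ≡⟨ cong (λ z → x + (- z)) (trans (sym (p-1•x≡-x _)) (×-assocˡ 1# p-1 s′)) ⟩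
      x + (- ((p-1 ℕ.* s′) • 1#))   ∎

  φ : Fin q → ℕ
  φ x = proj₁ (residue x) ℕ.% p

  φ<p : ∀ x → φ x ℕ.< p
  φ<p x = ℕ.m%n<n (proj₁ (residue x)) p

  φ-~ : ∀ x → x ~ φ x
  φ-~ x = subst (λ z → Mem H (x + (- z))) (sym (•-% (proj₁ (residue x)) 1#)) (proj₂ (residue x))

  ~-0 : 0# ~ 0
  ~-0 = subst (Mem H) (sym (trans (cong (0# +_) -0#≈0#) (+-identityʳ 0#))) (0∈ H)

  -‿+-hom : ∀ x y → - (x + y) ≡ (- x) + (- y)
  -‿+-hom x y = +-cancelˡ (x + y) _ _ (trans (-‿inverseʳ _) (sym (trans (+-interchange x y (- x) (- y))
                  (trans (cong₂ _+_ (-‿inverseʳ x) (-‿inverseʳ y)) (+-identityˡ 0#)))))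

  ~-+ : ∀ {x y s t} → x ~ s → y ~ t → (x + y) ~ (s ℕ.+ t)
  ~-+ {x} {y} {s} {t} x~s y~t = subst (Mem H) (begin
    (x + (- (s • 1#))) + (y + (- (t • 1#)))   ≡⟨ +-interchange _ _ _ _ ⟩
    (x + y) + ((- (s • 1#)) + (- (t • 1#)))   ≡⟨ cong ((x + y) +_) (sym (-‿+-hom _ _)) ⟩
    (x + y) + (- (s • 1# + t • 1#))           ≡⟨ cong (λ z → (x + y) + (- z)) (sym (×-homo-+ 1# s t)) ⟩
    (x + y) + (- ((s ℕ.+ t) • 1#))            ∎) (+∈ H x~s y~t)

  0~⇒p∣ : ∀ {t} → 0# ~ t → p ∣ t
  0~⇒p∣ {t} 0~t = H-multiples t (subst (Mem H) (trans (cong -_ (+-identityˡ _)) (-‿involutive _)) (-∈ H 0~t))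

  φ0≡0 : φ 0# ≡ 0
  φ0≡0 with φ 0# | φ<p 0# | 0~⇒p∣ {φ 0#} (φ-~ 0#)
  ... | zero  | _ | _ = refl
  ... | suc t | t<p | p∣t = ⊥-elim (ℕ.<⇒≱ t<p (ℕ∣.∣⇒≤ p∣t))

  1~⇒p∤ : ∀ {t} → 1# ~ t → ¬ p ∣ t
  1~⇒p∤ 1~t p∣t = 1∉H (subst (Mem H) (trans (cong (λ z → 1# + (- z)) (p∣⇒•1≡0 p∣t))
      (trans (cong (1# +_) -0#≈0#) (+-identityʳ 1#))) 1~t)

  -- The difference of `s • 1#` and `t • 1#` lies in `H`, so `H-multiples` applies. The term
  -- `p-1 * t` stands for `- t`.
  ~-unique : ∀ {x s t} → x ~ s → x ~ t → p ∣ (s ℕ.+ p-1 ℕ.* t)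
  ~-unique {x} {s} {t} x~s x~t = H-multiples _ (subst (Mem H) difference (+∈ H (-∈ H x~s) x~t))
    where
    a b : Fin q
    a = s • 1#
    b = t • 1#
    difference : (- (x + (- a))) + (x + (- b)) ≡ (s ℕ.+ p-1 ℕ.* t) • 1#
    difference = begin
      (- (x + (- a))) + (x + (- b))   ≡⟨ cong (_+ (x + (- b)))
          (trans (-‿+-hom x (- a)) (cong ((- x) +_) (-‿involutive a))) ⟩
      ((- x) + a) + (x + (- b))       ≡⟨ +-interchange (- x) a x (- b) ⟩
      ((- x) + x) + (a + (- b))       ≡⟨ trans (cong (_+ (a + (- b))) (-‿inverseˡ x)) (+-identityˡ (a + (- b))) ⟩
      a + (- b)                       ≡⟨ cong (a +_) (trans (sym (p-1•x≡-x b)) (×-assocˡ 1# p-1 t)) ⟩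
      a + (p-1 ℕ.* t) • 1#            ≡⟨ sym (×-homo-+ 1# s (p-1 ℕ.* t)) ⟩
      (s ℕ.+ p-1 ℕ.* t) • 1#          ∎

module _ where

  open import Data.Integer using (ℤ; +_; -[1+_]; _/ℕ_; _+_; _*_; -_)

  -- Derivations as growing lists of lines

  /ℕ-unique : ∀ d .{{_ : ℕ.NonZero d}} a r → r ℕ.< d → (+ d * a + + r) /ℕ d ≡ a
  /ℕ-unique d@(suc _) a r r<d = ℤ.≤-antisym (≤-from (ℤ.≤-<-trans (ℤ.[n/ℕd]*d≤n n d) upper))
      (≤-from (ℤ.≤-<-trans lower (ℤ.n<s[n/ℕd]*d n d)))
    where
    n = + d * a + + r
    lower : a * + d ℤ.≤ n
    lower = subst (ℤ._≤ n) (ℤ.*-comm (+ d) a) (ℤ.i≤i+j (+ d * a) (+ r))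
    upper : n ℤ.< ℤ.suc a * + d
    upper = subst (n ℤ.<_) (rearrange (+ d) a) (ℤ.+-monoʳ-< (+ d * a) (ℤ.+<+ r<d))
      where
      rearrange : ∀ d a → d * a + d ≡ (+ 1 + a) * d
      rearrange = solve-∀
    ≤-from : ∀ {x y} → x * + d ℤ.< ℤ.suc y * + d → x ℤ.≤ y
    ≤-from {x} {y} lt = subst (x ℤ.≤_) (ℤ.pred-suc y) (ℤ.i<j⇒i≤pred[j] (ℤ.*-cancelʳ-<-nonNeg {x} {ℤ.suc y} (+ d) lt))

  -- A form f stands for the inequality  f nothing + Σ_v f (just v) · v ≥ 0.
  Form : Set → Set
  Form V = Maybe V → ℤ

  module _ {V : Set} where

    infix 4 _≈_
    _≈_ : Form V → Form V → Set
    f ≈ g = ∀ x → f x ≡ g x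

    𝟎 𝟏 : Form V
    𝟎 _ = + 0
    𝟏 nothing  = + 1
    𝟏 (just _) = + 0

    -- As an inequality this reads f ≥ 1; in particular `pred 𝟎` is the contradiction 0 ≥ 1.
    pred : Form V → Form V
    pred f x = f x + - 𝟏 x

    ∑ : ∀ {A : Set} → List A → (A → Form V) → Form V
    ∑ xs f x = foldr (λ a s → f a x + s) (+ 0) xs

    toIneq : Form V → Ineq V
    toIneq f = (λ v → - f (just v)) ≤ᵢ f nothing

  module CuttingPlanes {V : Set} (_≟ᵥ_ : (u v : V) → Dec (u ≡ v)) (F : Clause V → Set) where

    record Proof : Set where
      constructor proof
      field
        {lines}    : List (Ineq V)
        derivation : Derivation _≟ᵥ_ F lines
    open Proof public

    -- Lines are matched up to `_≐_`, since their coefficients are functions and are compared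
    -- pointwise.
    record Has (W : Proof) (f : Form V) : Set where
      constructor has
      field
        line : Any (_≐ toIneq f) (lines W)

      index : Fin (length (lines W))
      index = Any.index line

      atIndex : lookup (lines W) index ≐ toIneq f
      atIndex = lookup-index line
    open Has public

    infix 4 _⊑_
    _⊑_ : Proof → Proof → Set
    W ⊑ W′ = ∀ {f} → Has W f → Has W′ f

    -- A monad graded by the number of new lines: `extends` transports everything derived before
    -- into the longer proof.
    record Ext (W : Proof) (s : ℕ) (P : Proof → Set) : Set where
      constructor ext
      field
        {target} : Proof
        extends  : W ⊑ target
        short    : length (lines target) ℕ.≤ s ℕ.+ length (lines W)
        holds    : P target
    open Ext public

    Derives : Proof → ℕ → Form V → Set
    Derives W s f = Ext W s (λ W′ → Has W′ f)

    ≐-trans : {I J L : Ineq V} → I ≐ J → J ≐ L → I ≐ L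
    ≐-trans (p , q) (p′ , q′) = (λ v → trans (p v) (p′ v)) , trans q q′

    toIneq-cong : {f g : Form V} → f ≈ g → toIneq f ≐ toIneq g
    toIneq-cong f≈g = (λ v → cong -_ (f≈g (just v))) , f≈g nothing

    Has-cong : ∀ {W f g} → f ≈ g → Has W f → Has W g
    Has-cong f≈g (has l) = has (Any.map (λ eq → ≐-trans eq (toIneq-cong f≈g)) l)

    return : ∀ {W P} → P W → Ext W 0 P
    return p = ext (λ x → x) ℕ.≤-refl p

    infixl 1 _>>=_
    _>>=_ : ∀ {W s t P Q} → Ext W s P → (∀ {W′} → W ⊑ W′ × P W′ → Ext W′ t Q) → Ext W (s ℕ.+ t) Q
    _>>=_ {W} {s} {t} (ext ρ s-short p) k with k (ρ , p)
    ... | ext ρ′ t-short q = ext (λ x → ρ′ (ρ x)) (begin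
      _                                 ≤⟨ t-short ⟩
      t ℕ.+ _                           ≤⟨ ℕ.+-monoʳ-≤ t s-short ⟩
      t ℕ.+ (s ℕ.+ length (lines W))    ≡⟨ sym (ℕ.+-assoc t s _) ⟩
      t ℕ.+ s ℕ.+ length (lines W)      ≡⟨ cong (ℕ._+ length (lines W)) (ℕ.+-comm t s) ⟩
      s ℕ.+ t ℕ.+ length (lines W)      ∎) q
      where open ℕ.≤-Reasoning

    weaken : ∀ {W s t P} → s ℕ.≤ t → Ext W s P → Ext W t P
    weaken s≤t (ext ρ short p) = ext ρ (ℕ.≤-trans short (ℕ.+-monoˡ-≤ _ s≤t)) p

    mapExt : ∀ {W s} {P Q : Proof → Set} → (∀ {W′} → W ⊑ W′ → P W′ → Q W′) → Ext W s P → Ext W s Q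
    mapExt h (ext ρ short p) = ext ρ short (h ρ p)

    append : ∀ {W L f} → Step _≟ᵥ_ F (lines W) L → L ≐ toIneq f → Derives W 1 f
    append {W} {L} step eq = ext {target = proof (derivation W ▷ step)} (λ (has l) → has (++⁺ˡ l))
      (ℕ.≤-reflexive (trans (List.length-++ (lines W)) (ℕ.+-comm (length (lines W)) 1)))
          (has (++⁺ʳ (lines W) (here eq)))

    byAxiom : ∀ {W A f} → Axiom _≟ᵥ_ F A → A ≐ toIneq f → Derives W 1 f
    byAxiom ax eq = append (axiom _ ax ((λ _ → refl) , refl)) eq

    byComb : ∀ {W f g h} c d → Has W f → Has W g → (∀ x → h x ≡ + c * f x + + d * g x) →
             Derives W 1 h
    byComb {W} {f} {g} {h} c d f∈ g∈ eq = append (comb (index f∈) (index g∈) c d ((λ _ → refl) , refl))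
      ((λ v → trans (cong₂ (λ x y → + c * x + + d * y) (proj₁ (atIndex f∈) v) (proj₁ (atIndex g∈) v))
                    (trans (negate (+ c) (+ d) (f (just v)) (g (just v))) (cong -_ (sym (eq (just v))))))
      , trans (cong₂ (λ x y → + c * x + + d * y) (proj₂ (atIndex f∈)) (proj₂ (atIndex g∈))) (sym (eq nothing)))
      where
      negate : ∀ c d x y → c * (- x) + d * (- y) ≡ - (c * x + d * y)
      negate = solve-∀

    -- The remainder `r` sits in the constant term alone, so the division rule rounds it away.
    byDiv : ∀ {W f g} k r → r ℕ.≤ k → Has W f → (∀ x → f x ≡ + suc k * g x + + r * 𝟏 x) →
            Derives W 1 g
    byDiv {W} {f} {g} k r r≤k f∈ eq = append
      (div (index f∈) k (λ v → ℤ∣.∣⇒∣ᵤ (ℤ∣.divides (- g (just v)) (divisible v))) ((λ _ → refl) , refl))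
      ((λ v → trans (cong (_/ℕ suc k) (trans (divisible v) (shape (g (just v)) (+ suc k))))
          (/ℕ-unique (suc k) (- g (just v)) 0 (s≤s z≤n)))
      , trans (cong (_/ℕ suc k) (trans (proj₂ (atIndex f∈))
          (trans (eq nothing) (cong (λ z → + suc k * g nothing + z) (ℤ.*-identityʳ (+ r))))))
              (/ℕ-unique (suc k) (g nothing) r (s≤s r≤k)))
      where
      collect : ∀ k r g → - (k * g + r * + 0) ≡ - g * k
      collect = solve-∀
      shape : ∀ g k → - g * k ≡ k * (- g) + + 0
      shape = solve-∀
      divisible : ∀ v → lhs (lookup (lines W) (index f∈)) v ≡ - g (just v) * + suc k
      divisible v = trans (proj₁ (atIndex f∈) v) (trans (cong -_ (eq (just v))) (collect (+ suc k) (+ r) (g (just v))))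

    Terms : Proof → Set
    Terms W = List (ℕ × ∃ (Has W))

    value : ∀ {W} → Terms W → Form V
    value ts x = foldr (λ (c , f , _) s → + c * f x + s) (+ 0) ts

    linear : ∀ {W f} → Has W 𝟎 → (ts : Terms W) → f ≈ value ts → Derives W (length ts) f
    linear 𝟎∈ [] eq = return (Has-cong (sym ∘ eq) 𝟎∈)
    linear {W} 𝟎∈ ((c , f , f∈) ∷ ts) eq = weaken (ℕ.≤-reflexive (ℕ.+-comm _ 1))
        (linear 𝟎∈ ts (λ _ → refl) >>= λ (ρ , rest∈) →
      byComb c 1 (ρ f∈) rest∈ λ x → trans (eq x) (cong (λ z → + c * f x + z) (sym (ℤ.*-identityˡ _))))

    sum-derivable : ∀ {A : Set} {W s} (xs : List A) {f : A → Form V} → Has W 𝟎 →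
                    (∀ {W′} → W ⊑ W′ → ∀ a → Derives W′ s (f a)) →
                    Derives W (length xs ℕ.* suc s) (∑ xs f)
    sum-derivable [] 𝟎∈ each = return 𝟎∈
    sum-derivable {s = s} (a ∷ xs) {f} 𝟎∈ each = weaken
        (ℕ.≤-reflexive (trans (sym (ℕ.+-assoc s 1 _)) (cong (ℕ._+ length xs ℕ.* suc s) (ℕ.+-comm s 1)))) (
      each (λ x → x) a >>= λ (ρ , fa∈) →
      weaken (ℕ.≤-reflexive (ℕ.+-comm _ 1)) (sum-derivable xs {f} (ρ 𝟎∈) (λ ρ′ → each (λ x → ρ′ (ρ x))) >>= λ
          (ρ′ , rest∈) →
      byComb 1 1 (ρ′ fa∈) rest∈ λ x → sym (cong₂ _+_ (ℤ.*-identityˡ (f a x)) (ℤ.*-identityˡ (∑ xs f x)))))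

    -- f ≥ 0 and k f ≥ r + 1 give (k + r + 1) f ≥ r + 1; now divide and round.
    round : ∀ {W f g} k r → Has W f → Has W g → (∀ x → g x ≡ + k * f x + - (+ suc r * 𝟏 x)) →
            Derives W 2 (pred f)
    round {f = f} {g} k r f∈ g∈ eq =
      byComb {h = λ x → + suc (r ℕ.+ k) * pred f x + + k * 𝟏 x} (suc r) 1 f∈ g∈
        (λ x → trans (shape (+ r) (+ k) (f x) (𝟏 x)) (cong (λ y → + suc r * f x + + 1 * y) (sym (eq x)))) >>= λ
            (_ , sum∈) →
      byDiv (r ℕ.+ k) k (ℕ.m≤n+m k r) sum∈ λ _ → refl
      where
      shape : ∀ r k f o → (+ 1 + (r + k)) * (f + - o) + k * o
                        ≡ (+ 1 + r) * f + + 1 * (k * f + - ((+ 1 + r) * o))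
      shape = solve-∀

    -- Reads g ≥ w up to the error `K h`. During a sweep `K` grows exponentially in `w`, which does
    -- no harm because size counts lines.
    climb : (g h : Form V) (w K : ℕ) → Form V
    climb g h w K x = g x + - (+ w * 𝟏 x) + + K * h x

    -- The values w = 0, …, bound of g are excluded one after the other,
    -- each time at the price of a larger multiple of h.
    sweep : ∀ {W} (g h : Form V) bound cost → Has W 𝟎 → Has W g → Has W h →
            Has W (λ x → + bound * 𝟏 x + - g x) →
            (∀ {W′} → W ⊑ W′ → ∀ w K → Has W′ (climb g h w K) →
               Derives W′ cost (climb g h (suc w) (suc (K ℕ.+ K)))) →
            Derives W (suc bound ℕ.* cost ℕ.+ 4) (pred h)
    sweep {W} g h bound cost 𝟎∈ g∈ h∈ upper∈ step =
      iterate (suc bound) (λ x → x) 0 0 (Has-cong (λ x → start (g x) (𝟏 x) (h x)) g∈) >>= λ (ρ , K , top∈) →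
      -- At `w = bound + 1` the upper bound cancels `g` and leaves K h ≥ 1, which rounds to h ≥ 1.
      linear (ρ 𝟎∈) ((1 , _ , ρ upper∈) ∷ (1 , _ , top∈) ∷ []) (λ x → collect x K) >>= λ (ρ′ , Kh∈) →
      round K 0 (ρ′ (ρ h∈)) Kh∈ λ x → refl
      where
      start : ∀ g o h → g ≡ g + - (+ 0 * o) + + 0 * h
      start = solve-∀
      iterate : ∀ n {W′} → W ⊑ W′ → ∀ w K → Has W′ (climb g h w K) →
                Ext W′ (n ℕ.* cost) (λ W″ → ∃[ K′ ] Has W″ (climb g h (n ℕ.+ w) K′))
      iterate zero    ρ w K now = return (K , now)
      iterate (suc n) {W′} ρ w K now = step ρ w K now >>= λ {W″} (ρ′ , next) →
        subst (λ i → Ext W″ (n ℕ.* cost) (λ U → ∃[ K′ ] Has U (climb g h i K′))) (ℕ.+-suc n w)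
            (iterate n (λ x → ρ′ (ρ x)) (suc w) (suc (K ℕ.+ K)) next)
      arith : ∀ b o g K h → K * h + - (+ 1 * o) ≡
        + 1 * (b * o + - g) + (+ 1 * (g + - ((+ 1 + b) * o) + K * h) + + 0)
      arith = solve-∀
      collect : ∀ x K → + K * h x + - (+ 1 * 𝟏 x) ≡
        + 1 * (+ bound * 𝟏 x + - g x) + (+ 1 * climb g h (suc bound ℕ.+ 0) K x + + 0)
      collect x K rewrite ℕ.+-identityʳ bound = arith (+ bound) (𝟏 x) (g x) (+ K) (h x)

  -- Splitting the equations in halves

  total : ∀ {A : Set} → (A → ℕ) → List A → ℕ
  total f = foldr (λ a s → f a ℕ.+ s) 0

  total-++ : ∀ {A : Set} (f : A → ℕ) xs ys → total f (xs ++ ys) ≡ total f xs ℕ.+ total f ys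
  total-++ f [] ys = refl
  total-++ f (x ∷ xs) ys = trans (cong (f x ℕ.+_) (total-++ f xs ys)) (sym (ℕ.+-assoc (f x) _ _))

  ∑-++ : ∀ {V A : Set} (xs ys : List A) (f : A → Form V) x → ∑ (xs ++ ys) f x ≡ ∑ xs f x + ∑ ys f x
  ∑-++ [] ys f x = sym (ℤ.+-identityˡ _)
  ∑-++ (a ∷ xs) ys f x = trans (cong (λ s → f a x + s) (∑-++ xs ys f x)) (sym (ℤ.+-assoc (f a x) _ _))

  ∑-complement : ∀ {V A : Set} (xs : List A) (f : A → Form V) D x →
                 ∑ xs (λ a y → + D * 𝟏 y + - f a y) x ≡ + (length xs ℕ.* D) * 𝟏 x + - ∑ xs f x
  ∑-complement [] f D x = refl
  ∑-complement (a ∷ xs) f D x = trans (cong (λ s → + D * 𝟏 x + - f a x + s) (∑-complement xs f D x))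
    (arith (+ D) (+ (length xs ℕ.* D)) (𝟏 x) (f a x) (∑ xs f x))
    where
    arith : ∀ d l o a s → d * o + - a + (l * o + - s) ≡ (d + l) * o + - (a + s)
    arith = solve-∀

  module _ {V : Set} where
    -- The two halves of h ≥ ∣ z - v ∣.
    above below : Form V → ℤ → Form V → Form V
    above z v h x = z x + - (v * 𝟏 x) + h x
    below z v h x = - z x + v * 𝟏 x + h x

  module DivideAndConquerCosts (D lowerCost upperCost leafCost M : ℕ) where

    boundsCost sweepLength : ℕ
    boundsCost  = M ℕ.* suc lowerCost ℕ.+ M ℕ.* suc upperCost
    sweepLength = suc (M ℕ.* D)

    -- The 2 is the rounding for an empty set of equations. The 6 counts the lines that produce `h′`
    -- and its two bounds at each value, the 4 the concluding combination and rounding of `sweep`.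
    cost : ℕ → ℕ
    cost zero    = leafCost ℕ.+ 2
    cost (suc k) = boundsCost ℕ.+ (sweepLength ℕ.* (cost k ℕ.+ 6) ℕ.+ 4)

    rootCost : ℕ → ℕ
    rootCost k = boundsCost ℕ.+ (3 ℕ.+ (sweepLength ℕ.* (cost k ℕ.+ 4) ℕ.+ 4))

  module _ {V : Set} (_≟ᵥ_ : (u v : V) → Dec (u ≡ v)) (F : Clause V → Set) where

    open CuttingPlanes _≟ᵥ_ F

    module _ {J : Set} (z : J → Form V) where

      LowerBounds : ℕ → Set
      LowerBounds cost = ∀ {W} → Has W 𝟎 → Has W 𝟏 → ∀ j → Derives W cost (z j)

      UpperBounds : ℕ → ℕ → Set
      UpperBounds D cost = ∀ {W} → Has W 𝟎 → Has W 𝟏 → ∀ j → Derives W cost (λ x → + D * 𝟏 x + - z j x)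

      -- z j = v is derived to be impossible in the form: any h ≥ ∣ z j - v ∣ is at least 1.
      Refutations : ℤ → (J → ℕ) → ℕ → Set
      Refutations P β cost = ∀ {W} → Has W 𝟎 → Has W 𝟏 → ∀ j v → ¬ (P ∣ℤ (v + - + β j)) → ∀ h →
        Has W h → Has W (above (z j) v h) → Has W (below (z j) v h) → Derives W cost (pred h)

    module DivideAndConquer
      {J : Set} (z : J → Form V) (β : J → ℕ) (p-1 D lowerCost upperCost leafCost M : ℕ)
      (lower : LowerBounds z lowerCost) (upper : UpperBounds z D upperCost)
          (leaf : Refutations z (+ suc p-1) β leafCost)
      where

      P : ℤ
      P = + suc p-1

      open DivideAndConquerCosts D lowerCost upperCost leafCost M public

      bounds : ∀ {W} (S : List J) → length S ℕ.≤ M → Has W 𝟎 → Has W 𝟏 →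
               Ext W boundsCost (λ W′ → Has W′ (∑ S z) × Has W′ (λ x → + (length S ℕ.* D) * 𝟏 x + - ∑ S z x))
      bounds S len 𝟎∈ 𝟏∈ =
        weaken (ℕ.+-mono-≤ (ℕ.*-monoˡ-≤ (suc lowerCost) len) (ℕ.*-monoˡ-≤ (suc upperCost) len)) (
        sum-derivable S {z} 𝟎∈ (λ ρ j → lower (ρ 𝟎∈) (ρ 𝟏∈) j) >>= λ (ρ , low∈) →
        mapExt (λ ρ′ up∈ → ρ′ low∈ , Has-cong (∑-complement S z D) up∈)
          (sum-derivable S {λ j x → + D * 𝟏 x + - z j x} (ρ 𝟎∈) (λ ρ′ j → upper (ρ′ (ρ 𝟎∈)) (ρ′ (ρ 𝟏∈)) j)))

      refute : ∀ k S → length S ℕ.≤ 2 ℕ.^ k → length S ℕ.≤ M → ∀ {W} → Has W 𝟎 → Has W 𝟏 →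
               ∀ v → ¬ (P ∣ℤ (v + - + total β S)) → ∀ h → Has W h →
               Has W (above (∑ S z) v h) → Has W (below (∑ S z) v h) → Derives W (cost k) (pred h)
      -- For the empty list both sums are 0, so `v` is nonzero and one of the two bounds reads h ≥ ∣
      -- v ∣.
      refute zero [] _ _ 𝟎∈ 𝟏∈ (+ zero) v≢β h h∈ above∈ below∈ = contradiction (ℤ∣.divides (+ 0) refl) v≢β
      refute zero [] _ _ 𝟎∈ 𝟏∈ (+ suc r) v≢β h h∈ above∈ below∈ =
        weaken (ℕ.m≤n+m 2 leafCost) (round 1 r h∈ above∈ λ x → arith (h x) (+ suc r * 𝟏 x))
        where
        arith : ∀ h w → + 0 + - w + h ≡ + 1 * h + - w
        arith = solve-∀
      refute zero [] _ _ 𝟎∈ 𝟏∈ -[1+ r ] v≢β h h∈ above∈ below∈ =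
        weaken (ℕ.m≤n+m 2 leafCost) (round 1 r h∈ below∈ λ x → arith (h x) (+ suc r) (𝟏 x))
        where
        arith : ∀ h w o → + 0 + (- w) * o + h ≡ + 1 * h + - (w * o)
        arith = solve-∀
      refute zero (j ∷ []) _ _ 𝟎∈ 𝟏∈ v v≢β h h∈ above∈ below∈ =
        weaken (ℕ.m≤m+n leafCost 2) (leaf 𝟎∈ 𝟏∈ j v (subst (λ b → ¬ (P ∣ℤ (v + - + b))) (ℕ.+-identityʳ (β j)) v≢β) h h∈
          (Has-cong (λ x → cong (λ y → y + - (v * 𝟏 x) + h x) (ℤ.+-identityʳ (z j x))) above∈)
          (Has-cong (λ x → cong (λ y → - y + v * 𝟏 x + h x) (ℤ.+-identityʳ (z j x))) below∈))
      refute zero (_ ∷ _ ∷ _) (s≤s ()) _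
      refute (suc k) S len len′ {W} 𝟎∈ 𝟏∈ v v≢β h h∈ above∈ below∈ =
        bounds S₁ len₁′ 𝟎∈ 𝟏∈ >>= λ (ρ , low∈ , up∈) →
        weaken (ℕ.+-monoˡ-≤ 4 (ℕ.*-monoˡ-≤ (cost k ℕ.+ 6) (s≤s (ℕ.*-monoˡ-≤ D len₁′)))) (
        sweep g h (length S₁ ℕ.* D) (cost k ℕ.+ 6) (ρ 𝟎∈) low∈ (ρ h∈) up∈ λ ρ′ →
          step (ρ′ (ρ 𝟎∈)) (ρ′ (ρ 𝟏∈)) (ρ′ (ρ h∈)) (ρ′ (ρ above∈)) (ρ′ (ρ below∈)))
        where
        S₁ S₂ : List J
        S₁ = take (2 ℕ.^ k) S
        S₂ = drop (2 ℕ.^ k) S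

        g z₂ : Form V
        g  = ∑ S₁ z
        z₂ = ∑ S₂ z

        len₁ : length S₁ ℕ.≤ 2 ℕ.^ k
        len₁ = subst (ℕ._≤ 2 ℕ.^ k) (sym (List.length-take (2 ℕ.^ k) S)) (ℕ.m⊓n≤m _ _)
        len₁′ : length S₁ ℕ.≤ M
        len₁′ = ℕ.≤-trans (subst (ℕ._≤ length S) (sym (List.length-take (2 ℕ.^ k) S)) (ℕ.m⊓n≤n (2 ℕ.^ k) _)) len′
        len₂ : length S₂ ℕ.≤ 2 ℕ.^ k
        len₂ = subst (ℕ._≤ 2 ℕ.^ k) (sym (List.length-drop (2 ℕ.^ k) S))
                 (ℕ.m≤n+o⇒m∸n≤o (length S) (2 ℕ.^ k) (subst (length S ℕ.≤_)
                     (cong (2 ℕ.^ k ℕ.+_) (ℕ.+-identityʳ _)) len))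
        len₂′ : length S₂ ℕ.≤ M
        len₂′ = ℕ.≤-trans (subst (ℕ._≤ length S) (sym (List.length-drop (2 ℕ.^ k) S))
            (ℕ.m∸n≤m (length S) (2 ℕ.^ k))) len′

        S-split : S₁ ++ S₂ ≡ S
        S-split = List.take++drop≡id (2 ℕ.^ k) S

        z-split : ∀ x → ∑ S z x ≡ g x + z₂ x
        z-split x = trans (cong (λ T → ∑ T z x) (sym S-split)) (∑-++ S₁ S₂ z x)

        β-split : total β S ≡ total β S₁ ℕ.+ total β S₂
        β-split = trans (cong (total β) (sym S-split)) (total-++ β S₁ S₂)

        other-half : ∀ w → P ∣ℤ (+ w + - + total β S₁) → ¬ (P ∣ℤ (v + - + w + - + total β S₂))
        other-half w w≡β₁ v-w≡β₂ = v≢β (subst (P ∣ℤ_)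
          (trans (arith v (+ w) (+ total β S₁) (+ total β S₂)) (cong (λ b → v + - + b) (sym β-split)))
              (ℤ∣.∣m∣n⇒∣m+n w≡β₁ v-w≡β₂))
          where
          arith : ∀ v w b c → (w + - b) + (v + - w + - c) ≡ v + - (b + c)
          arith = solve-∀

        step : ∀ {W} → Has W 𝟎 → Has W 𝟏 → Has W h → Has W (above (∑ S z) v h) → Has W (below (∑ S z) v h) →
               ∀ w K → Has W (climb g h w K) →
               Derives W (cost k ℕ.+ 6) (climb g h (suc w) (suc (K ℕ.+ K)))
        step {W} 𝟎∈ 𝟏∈ h∈ above∈ below∈ w K now = weaken (ℕ.≤-reflexive (ℕ.+-comm 6 (cost k))) (
          mapExt (λ _ → Has-cong λ x → raise (g x) (+ w) (𝟏 x) (+ suc (K ℕ.+ K) * h x)) next)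
          where
          -- The factor `2 K + 1` lets the same `h′` serve both halves: together with `now` and h ≥
          -- 0 it bounds ∣ g - w ∣, and adding the bounds on the whole sum it bounds ∣ z₂ - (v - w)
          -- ∣. The conclusion h′ ≥ 1 is literally the next `climb`.
          h′ : Form V
          h′ = climb g h w (suc (K ℕ.+ K))
          raise : ∀ g w o h → g + - (w * o) + h + - o ≡ g + - ((+ 1 + w) * o) + h
          raise = solve-∀
          e₁ : ∀ g w o K h → g + - (w * o) + (+ 1 + (K + K)) * h ≡
               + 1 * (g + - (w * o) + K * h) + ((+ 1 + K) * h + + 0)
          e₁ = solve-∀
          e₂ : ∀ g w o K h → g + - (w * o) + (g + - (w * o) + (+ 1 + (K + K)) * h) ≡
               + 2 * (g + - (w * o) + K * h) + (+ 1 * h + + 0)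
          e₂ = solve-∀
          e₃ : ∀ g w o K h → - g + w * o + (g + - (w * o) + (+ 1 + (K + K)) * h) ≡ (+ 1 + (K + K)) * h + + 0
          e₃ = solve-∀
          e₄ : ∀ g y v w o K h → y + - ((v + - w) * o) + (g + - (w * o) + (+ 1 + (K + K)) * h) ≡
               + 1 * ((g + y) + - (v * o) + h) + ((K + K) * h + + 0)
          e₄ = solve-∀
          e₅ : ∀ g y v w o K h → - y + (v + - w) * o + (g + - (w * o) + (+ 1 + (K + K)) * h) ≡
               + 2 * (g + - (w * o) + K * h) + (+ 1 * (- (g + y) + v * o + h) + + 0)
          e₅ = solve-∀
          next : Derives W (6 ℕ.+ cost k) (pred h′)
          next with P ∣ℤ? (+ w + - + total β S₁)
          ... | no w≢β₁ = weaken (ℕ.n≤1+n _) (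
            linear 𝟎∈ ((1 , _ , now) ∷ (suc K , _ , h∈) ∷ []) (λ x → e₁ (g x) (+ w) (𝟏 x) (+ K) (h x)) >>= λ (ρ , h′∈) →
            linear (ρ 𝟎∈) ((2 , _ , ρ now) ∷ (1 , _ , ρ h∈) ∷ []) (λ x → e₂ (g x) (+ w) (𝟏 x) (+ K) (h x)) >>= λ
                (ρ′ , above′∈) →
            linear (ρ′ (ρ 𝟎∈)) ((suc (K ℕ.+ K) , _ , ρ′ (ρ h∈)) ∷ []) (λ x → e₃ (g x) (+ w) (𝟏 x) (+ K) (h x))
                >>= λ (ρ″ , below′∈) →
            refute k S₁ len₁ len₁′ (ρ″ (ρ′ (ρ 𝟎∈))) (ρ″ (ρ′ (ρ 𝟏∈))) (+ w) w≢β₁ h′ (ρ″ (ρ′ h′∈)) (ρ″ above′∈) below′∈)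
          ... | yes w≡β₁ =
            linear 𝟎∈ ((1 , _ , now) ∷ (suc K , _ , h∈) ∷ []) (λ x → e₁ (g x) (+ w) (𝟏 x) (+ K) (h x)) >>= λ (ρ , h′∈) →
            linear (ρ 𝟎∈) ((1 , _ , ρ above∈) ∷ (K ℕ.+ K , _ , ρ h∈) ∷ [])
              (λ x → trans (e₄ (g x) (z₂ x) v (+ w) (𝟏 x) (+ K) (h x))
                           (cong (λ y → + 1 * (y + - (v * 𝟏 x) + h x) + (+ (K ℕ.+ K) * h x + + 0))
                               (sym (z-split x)))) >>= λ (ρ′ , above′∈) →
            linear (ρ′ (ρ 𝟎∈)) ((2 , _ , ρ′ (ρ now)) ∷ (1 , _ , ρ′ (ρ below∈)) ∷ [])
              (λ x → trans (e₅ (g x) (z₂ x) v (+ w) (𝟏 x) (+ K) (h x))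
                           (cong (λ y → + 2 * climb g h w K x + (+ 1 * (- y + v * 𝟏 x + h x) + + 0))
                               (sym (z-split x)))) >>= λ (ρ″ , below′∈) →
            refute k S₂ len₂ len₂′ (ρ″ (ρ′ (ρ 𝟎∈))) (ρ″ (ρ′ (ρ 𝟏∈))) (v + - + w) (other-half w w≡β₁) h′
                (ρ″ (ρ′ h′∈)) (ρ″ above′∈) below′∈

      -- The form `ζ` is swept with the error `𝟎`, so the outcome of `sweep` is the contradiction
      -- `pred 𝟎`.
      refuteAll : ∀ k S → length S ℕ.≤ 2 ℕ.^ k → length S ℕ.≤ M → ∀ {W} → Has W 𝟎 → Has W 𝟏 →
                  ∀ ζ → (∀ x → ∑ S z x ≡ P * ζ x) → ¬ (P ∣ℤ (+ total β S)) →
                  Derives W (rootCost k) (pred 𝟎)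
      refuteAll k S len len′ 𝟎∈ 𝟏∈ ζ z≡Pζ P∤β =
        bounds S len′ 𝟎∈ 𝟏∈ >>= λ (ρ , low∈ , up∈) →
        byDiv p-1 0 z≤n low∈ (λ x → trans (z≡Pζ x) (sym (ℤ.+-identityʳ (P * ζ x)))) >>= λ (ρ′ , ζ∈) →
        -- The upper bound on `P ζ` also holds for `ζ`: the difference `p-1 ζ` is nonnegative.
        linear (ρ′ (ρ 𝟎∈)) ((1 , _ , ρ′ up∈) ∷ (p-1 , _ , ζ∈) ∷ []) upper-eq >>= λ (ρ″ , ζ-up∈) →
        weaken (ℕ.+-monoˡ-≤ 4 (ℕ.*-monoˡ-≤ (cost k ℕ.+ 4) (s≤s (ℕ.*-monoˡ-≤ D len′)))) (
        sweep ζ 𝟎 (length S ℕ.* D) (cost k ℕ.+ 4) (ρ″ (ρ′ (ρ 𝟎∈))) (ρ″ ζ∈) (ρ″ (ρ′ (ρ 𝟎∈))) ζ-up∈ λ ρ‴ →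
          step (ρ‴ (ρ″ (ρ′ (ρ 𝟎∈)))) (ρ‴ (ρ″ (ρ′ (ρ 𝟏∈)))))
        where
        upper-eq : ∀ x → + (length S ℕ.* D) * 𝟏 x + - ζ x ≡
          + 1 * (+ (length S ℕ.* D) * 𝟏 x + - ∑ S z x) + (+ p-1 * ζ x + + 0)
        upper-eq x = trans (arith (+ (length S ℕ.* D) * 𝟏 x) (+ p-1) (ζ x))
          (cong (λ y → + 1 * (+ (length S ℕ.* D) * 𝟏 x + - y) + (+ p-1 * ζ x + + 0)) (sym (z≡Pζ x)))
          where
          arith : ∀ d r t → d + - t ≡ + 1 * (d + - ((+ 1 + r) * t)) + (r * t + + 0)
          arith = solve-∀
        step : ∀ {W} → Has W 𝟎 → Has W 𝟏 → ∀ w K → Has W (climb ζ 𝟎 w K) →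
               Derives W (cost k ℕ.+ 4) (climb ζ 𝟎 (suc w) (suc (K ℕ.+ K)))
        step 𝟎∈ 𝟏∈ w K now = weaken (ℕ.≤-reflexive (trans (cong (2 ℕ.+_) (ℕ.+-comm (cost k) 2))
            (ℕ.+-comm 4 (cost k)))) (
          linear 𝟎∈ ((suc p-1 , _ , now) ∷ []) (λ x → e₁ P (ζ x) (+ w) (𝟏 x) (+ K)) >>= λ (ρ , h∈) →
          linear (ρ 𝟎∈) ((suc p-1 ℕ.+ suc p-1 , _ , ρ now) ∷ [])
            (λ x → trans (cong (λ y → y + - (P * + w * 𝟏 x) + h x) (z≡Pζ x)) (e₂ P (ζ x) (+ w) (𝟏 x) (+ K))) >>=
                λ (ρ′ , above∈) →
          refute k S len len′ (ρ′ (ρ 𝟎∈)) (ρ′ (ρ 𝟏∈)) (P * + w) Pw≢β h (ρ′ h∈) above∈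
            (Has-cong (λ x → trans (e₃ P (ζ x) (+ w) (𝟏 x))
                (cong (λ y → - y + P * + w * 𝟏 x + h x) (sym (z≡Pζ x)))) (ρ′ (ρ 𝟎∈))) >>= λ (ρ″ , pred-h∈) →
          mapExt (λ _ → Has-cong λ x → e₄ (ζ x) (+ w) (𝟏 x) (+ K)) (
          round (suc p-1) 0 (ρ″ (ρ′ (ρ now))) pred-h∈ λ x → e₅ P (ζ x) (+ w) (𝟏 x) (+ K)))
          where
          -- Once ζ ≥ w is known, `P (ζ - w)` is nonnegative and equals the sum minus `P w`, so it
          -- is its own error term for the value `P w`. That value is 0 modulo `P`, hence not
          -- congruent to the total of `β`.
          h : Form V
          h x = P * (ζ x + - (+ w * 𝟏 x))
          Pw≢β : ¬ (P ∣ℤ (P * + w + - + total β S))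
          Pw≢β P∣ = P∤β (subst (P ∣ℤ_) (arith (P * + w) (+ total β S))
              (ℤ∣.∣m∣n⇒∣m+n (ℤ∣.divides (+ w) (ℤ.*-comm P (+ w))) (ℤ∣.∣m⇒∣-m P∣)))
            where
            arith : ∀ a b → a + - (a + - b) ≡ b
            arith = solve-∀
          e₁ : ∀ P t w o K → P * (t + - (w * o)) ≡ P * (t + - (w * o) + K * + 0) + + 0
          e₁ = solve-∀
          e₂ : ∀ P t w o K → P * t + - (P * w * o) + P * (t + - (w * o)) ≡ (P + P) * (t + - (w * o) + K * + 0) + + 0
          e₂ = solve-∀
          e₃ : ∀ P t w o → + 0 ≡ - (P * t) + P * w * o + P * (t + - (w * o))
          e₃ = solve-∀
          e₄ : ∀ t w o K → t + - (w * o) + K * + 0 + - o ≡ t + - ((+ 1 + w) * o) + (+ 1 + (K + K)) * + 0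
          e₄ = solve-∀
          e₅ : ∀ P t w o K → P * (t + - (w * o)) + - o ≡ P * (t + - (w * o) + K * + 0) + - (+ 1 * o)
          e₅ = solve-∀

  -- Finite sums over variables and values.

  module _ {M : Set} (_∙_ : M → M → M) (ε : M) (identityˡ : ∀ x → ε ∙ x ≡ x) where

    foldr-zero : ∀ {A : Set} {g : A → M} {xs} → All (λ a → g a ≡ ε) xs → foldr (λ a s → g a ∙ s) ε xs ≡ ε
    foldr-zero [] = refl
    foldr-zero (ga≡ε ∷ rest) = trans (cong₂ _∙_ ga≡ε (foldr-zero rest)) (identityˡ ε)

    foldr-pick : (∀ x → x ∙ ε ≡ x) → ∀ {A : Set} {g : A → M} {xs a} → Unique xs → a ∈ xs →
                 (∀ b → b ≢ a → g b ≡ ε) → foldr (λ a s → g a ∙ s) ε xs ≡ g a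
    foldr-pick identityʳ {g = g} {a = a} (a∉ ∷ _) (here refl) zero-off =
      trans (cong (g a ∙_) (foldr-zero (All.map (λ a≢b → zero-off _ (a≢b ∘ sym)) a∉))) (identityʳ _)
    foldr-pick identityʳ {xs = b ∷ _} (b∉ ∷ uniq) (there a∈) zero-off =
      trans (cong₂ _∙_ (zero-off b (All.lookup b∉ a∈)) (foldr-pick identityʳ uniq a∈ zero-off)) (identityˡ _)

  module _ {q : ℕ} (K : FiniteField q) where

    allFin′-unique : ∀ n → Unique (allFin′ K n)
    allFin′-unique zero    = []
    allFin′-unique (suc n) = All.map⁺ (All.universal (λ _ ()) (allFin′ K n)) ∷ Unique.map⁺ suc-injective
        (allFin′-unique n)

    length-allFin′ : ∀ n → length (allFin′ K n) ≡ n
    length-allFin′ zero    = refl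
    length-allFin′ (suc n) = cong suc (trans (List.length-map fsuc (allFin′ K n)) (length-allFin′ n))

    support-unique : ∀ {n} (e : Equation q n) → Unique (support K e)
    support-unique {n} e = Unique.filter⁺ _ (allFin′-unique n)

  ∑-map : ∀ {V A B : Set} (f : A → B) (xs : List A) (g : B → Form V) x → ∑ (map f xs) g x ≡ ∑ xs (g ∘ f) x
  ∑-map f xs g x = List.foldr-map (λ b s → g b x + s) f (+ 0) xs

  ∑-cong-All : ∀ {V A : Set} {xs : List A} (f g : A → Form V) x → All (λ a → f a x ≡ g a x) xs → ∑ xs f x ≡ ∑ xs g x
  ∑-cong-All f g x [] = refl
  ∑-cong-All f g x (eq ∷ eqs) = cong₂ _+_ eq (∑-cong-All f g x eqs)

  -- The weights s = ±1 yield upper and lower bounds for the sum of the g a.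
  ∑-deviation : ∀ {V A : Set} (s : ℤ) (B : ℕ) (t : Form V) (c : A → ℕ) (g : A → Form V) xs x →
    ∑ xs (λ a y → + B * t y + s * (+ c a * 𝟏 y + - g a y)) x ≡
    + (length xs ℕ.* B) * t x + s * (+ total c xs * 𝟏 x + - ∑ xs g x)
  ∑-deviation s B t c g [] x = sym (trans (arith s (t x) (𝟏 x)) refl)
    where
    arith : ∀ s t o → + 0 * t + s * (+ 0 * o + - + 0) ≡ + 0
    arith = solve-∀
  ∑-deviation s B t c g (a ∷ xs) x =
    trans (cong (λ r → + B * t x + s * (+ c a * 𝟏 x + - g a x) + r) (∑-deviation s B t c g xs x))
          (arith s (+ B) (t x) (+ c a) (𝟏 x) (g a x) (+ (length xs ℕ.* B)) (+ total c xs) (∑ xs g x))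
    where
    arith : ∀ s b t c o g l k r → b * t + s * (c * o + - g) + (l * t + s * (k * o + - r)) ≡
            (b + l) * t + s * ((c + k) * o + - (g + r))
    arith = solve-∀

  -- Here the error form varies with the index. This version runs over the variables of an equation,
  -- `∑-deviation` over the values of one variable.
  ∑-deviation′ : ∀ {V A : Set} (s : ℤ) (C : ℕ) (t : A → Form V) (c : A → ℕ) (g : A → Form V) xs x →
    ∑ xs (λ a y → + C * t a y + s * (+ c a * 𝟏 y + - g a y)) x ≡
    + C * ∑ xs t x + s * (+ total c xs * 𝟏 x + - ∑ xs g x)
  ∑-deviation′ s C t c g [] x = sym (arith s (+ C) (𝟏 x))
    where
    arith : ∀ s t o → t * + 0 + s * (+ 0 * o + - + 0) ≡ + 0
    arith = solve-∀
  ∑-deviation′ s C t c g (a ∷ xs) x =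
    trans (cong (λ r → + C * t a x + s * (+ c a * 𝟏 x + - g a x) + r) (∑-deviation′ s C t c g xs x))
          (arith s (+ C) (t a x) (+ c a) (𝟏 x) (g a x) (∑ xs t x) (+ total c xs) (∑ xs g x))
    where
    arith : ∀ s b t c o g l k r → b * t + s * (c * o + - g) + (b * l + s * (k * o + - r)) ≡
            b * (t + l) + s * ((c + k) * o + - (g + r))
    arith = solve-∀

  module Costs (q d : ℕ) where

    -- `D` bounds an integral form with at most `d` variables, `q` values each and coefficients at
    -- most `q`. In `leafCost` each of the `q ^ d` assignments pays `baseCost` and its share of the
    -- resolution.
    D lowerCost upperCost baseCost leafCost : ℕ
    D         = d ℕ.* (q ℕ.* q)
    lowerCost = d ℕ.* suc (q ℕ.* 3)
    upperCost = d ℕ.* suc (q ℕ.* 4) ℕ.+ 2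
    baseCost  = d ℕ.* suc (q ℕ.* 5) ℕ.+ (d ℕ.* 2 ℕ.+ ((d ℕ.* 2 ℕ.+ 2) ℕ.+ 6))
    leafCost  = q ℕ.^ d ℕ.* (baseCost ℕ.+ d ℕ.* suc (d ℕ.* 2 ℕ.+ 7))

  -- The case of a single equation

  module Encoding {q n m : ℕ} (K : FiniteField q) (sys : Fin m → Equation q n) where

    open FiniteField K using (0#; 1#; _⁻¹) renaming (_+_ to _⊕_; _*_ to _⊛_; -_ to ⊖_)

    V : Set
    V = BVar n q

    open CuttingPlanes (_≟ᴮ_ {n} {q}) (InCNF K sys) public

    y ¬y : V → Form V
    y v nothing  = + 0
    y v (just u) = indicator _≟ᴮ_ v u
    ¬y v x = 𝟏 x + - y v x

    y≥0 : ∀ {W} v → Derives W 1 (y v)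
    y≥0 v = byAxiom (lowerAx v) ((λ _ → refl) , refl)

    y≤1 : ∀ {W} v → Derives W 1 (¬y v)
    y≤1 v = byAxiom (upperAx v) ((λ u → arith (y v (just u))) , refl)
      where
      arith : ∀ i → i ≡ - (+ 0 + - i)
      arith = solve-∀

    literal : Literal V → Form V
    literal (pos v) = y v
    literal (neg v) = ¬y v

    byClause : ∀ {W} C → InCNF K sys C → Derives W 1 (pred (∑ C literal))
    byClause C C∈F = byAxiom (clauseAx C C∈F) ((λ v → trans (coefficients C v)
        (drop-zero (∑ C literal (just v)))) , cong (_+ - + 1) (constants C))
      where
      drop-zero : ∀ s → - s ≡ - (s + - + 0)
      drop-zero = solve-∀
      pos-coeff : ∀ i s → - i + - s ≡ - (i + s)
      pos-coeff = solve-∀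
      neg-coeff : ∀ i s → i + - s ≡ - (+ 0 + - i + s)
      neg-coeff = solve-∀
      coefficients : ∀ C v → foldr (λ l s → litCoeff _≟ᴮ_ l v + s) (+ 0) C ≡ - ∑ C literal (just v)
      coefficients []          v = refl
      coefficients (pos u ∷ C) v = trans (cong (λ s → - y u (just v) + s) (coefficients C v))
          (pos-coeff (y u (just v)) (∑ C literal (just v)))
      coefficients (neg u ∷ C) v = trans (cong (λ s → y u (just v) + s) (coefficients C v))
          (neg-coeff (y u (just v)) (∑ C literal (just v)))
      constants : ∀ C → + negCount _≟ᴮ_ C ≡ ∑ C literal nothing
      constants []          = refl
      constants (pos _ ∷ C) = trans (constants C) (sym (ℤ.+-identityˡ _))
      constants (neg _ ∷ C) = cong (λ s → + 1 + s) (constants C)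

    values : List (Fin q)
    values = allFin′ K q

    -- On one-hot points this counts the variables of `us` whose value differs from `σ`. Thus X + h
    -- ≥ 1 expresses that h ≥ 1 holds under the assignment `σ`.
    X : List (Fin n) → (Fin n → Fin q) → Form V
    X us σ = ∑ us (λ u → ¬y (u , σ u))

    X-derivable : ∀ {W} us σ → Has W 𝟎 → Derives W (length us ℕ.* 2) (X us σ)
    X-derivable us σ 𝟎∈ = sum-derivable us {λ u → ¬y (u , σ u)} 𝟎∈ λ _ u → y≤1 (u , σ u)

    infixl 6 _⊞_
    _⊞_ : Form V → Form V → Form V
    (f ⊞ g) x = f x + g x

    X⊞h-derivable : ∀ {W} us σ {h} → Has W 𝟎 → Has W h → Derives W (length us ℕ.* 2 ℕ.+ 2) (X us σ ⊞ h)
    X⊞h-derivable us σ {h} 𝟎∈ h∈ = X-derivable us σ 𝟎∈ >>= λ (ρ , X∈) →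
      linear (ρ 𝟎∈) ((1 , _ , X∈) ∷ (1 , _ , ρ h∈) ∷ []) λ x → arith (X us σ x) (h x)
      where
      arith : ∀ a b → a + b ≡ + 1 * a + (+ 1 * b + + 0)
      arith = solve-∀

    _[_≔_] : (Fin n → Fin q) → Fin n → Fin q → Fin n → Fin q
    (σ [ v ≔ a ]) u = if does (u ≟ᶠ v) then a else σ u

    X-update : ∀ {v us} σ a → All (v ≢_) us → ∀ x → X (v ∷ us) (σ [ v ≔ a ]) x ≡ ¬y (v , a) x + X us σ x
    X-update {v} {us} σ a v∉us x = cong₂ _+_ (cong (λ b → ¬y (v , b) x) at-v)
        (∑-cong-All (λ u → ¬y (u , (σ [ v ≔ a ]) u)) (λ u → ¬y (u , σ u)) x
            (All.map (λ {u} v≢u → cong (λ b → ¬y (u , b) x) (off-v v≢u)) v∉us))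
      where
      at-v : (σ [ v ≔ a ]) v ≡ a
      at-v with v ≟ᶠ v
      ... | yes _ = refl
      ... | no  v≢v = contradiction refl v≢v
      off-v : ∀ {u} → v ≢ u → (σ [ v ≔ a ]) u ≡ σ u
      off-v {u} v≢u with u ≟ᶠ v
      ... | yes u≡v = contradiction (sym u≡v) v≢u
      ... | no  _   = refl

    module Resolution (d : ℕ) {h : Form V} {W₀ : Proof} (𝟎∈ : Has W₀ 𝟎) (h∈ : Has W₀ h) where

      stepCost : ℕ
      stepCost = d ℕ.* 2 ℕ.+ 7

      -- Adding up the inequalities for the q values a of v, the sum of the ¬y (v , a)
      -- is q - ∑ y (v , a) ≤ q - 1.
      eliminate : ∀ {v us t} → length us ℕ.≤ d → All (v ≢_) us →
        (∀ {W} → W₀ ⊑ W → ∀ σ → Derives W t (pred (X (v ∷ us) σ ⊞ h))) →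
        (∀ {W} → W₀ ⊑ W → ∀ σ → Derives W (q ℕ.* suc t ℕ.+ stepCost) (pred (X us σ ⊞ h)))
      eliminate {v} {us} {t} len v∉us premise ρ₀ σ =
        weaken (ℕ.+-mono-≤ (ℕ.≤-reflexive (cong (ℕ._* suc t) (length-allFin′ K q)))
                 (ℕ.≤-trans (ℕ.+-monoʳ-≤ 3 (ℕ.≤-reflexive (ℕ.+-assoc (length us ℕ.* 2) 2 2)))
                   (ℕ.≤-trans (ℕ.≤-reflexive (ℕ.+-comm 3 (length us ℕ.* 2 ℕ.+ 4)))
                     (ℕ.≤-trans (ℕ.≤-reflexive (ℕ.+-assoc (length us ℕ.* 2) 4 3))
                         (ℕ.+-monoˡ-≤ 7 (ℕ.*-monoˡ-≤ 2 len)))))) (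
        sum-derivable values {case-form} (ρ₀ 𝟎∈) (λ ρ a → mapExt
            (λ _ → Has-cong (λ x → cong (λ s → s + h x + - 𝟏 x) (X-update σ a v∉us x)))
                (premise (λ w → ρ (ρ₀ w)) (σ [ v ≔ a ]))) >>= λ (ρ₁ , cases∈) →
        byClause _ (atLeastOne v) >>= λ (ρ₂ , clause∈) →
        linear (ρ₂ (ρ₁ (ρ₀ 𝟎∈))) ((1 , _ , ρ₂ cases∈) ∷ (1 , _ , clause∈) ∷ []) combine-eq >>= λ (ρ₃ , sum∈) →
        X⊞h-derivable us σ (ρ₃ (ρ₂ (ρ₁ (ρ₀ 𝟎∈)))) (ρ₃ (ρ₂ (ρ₁ (ρ₀ h∈)))) >>= λ (ρ₄ , Xh∈) →
        round (length values) 0 Xh∈ (ρ₄ sum∈) (λ _ → refl))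
        where
        case-form : Fin q → Form V
        case-form a = pred ((¬y (v , a) ⊞ X us σ) ⊞ h)
        arith : ∀ l o y s z a b → o + - y + a + b + - o + (l * (a + b) + - s) ≡ (+ 1 + l) * (a + b) + - (y + s)
        arith = solve-∀
        cases-sum : ∀ as x → ∑ as case-form x ≡ + length as * (X us σ ⊞ h) x + - ∑ as (λ a → y (v , a)) x
        cases-sum [] x = refl
        cases-sum (a ∷ as) x = trans (cong (λ s → case-form a x + s) (cases-sum as x))
          (arith (+ length as) (𝟏 x) (y (v , a) x) (∑ as (λ a → y (v , a)) x) (+ 0) (X us σ x) (h x))
        arith₂ : ∀ a o s → a + - (+ 1 * o) ≡ + 1 * (a + - s) + (+ 1 * (s + - o) + + 0)
        arith₂ = solve-∀
        combine-eq : ∀ x → + length values * (X us σ ⊞ h) x + - (+ 1 * 𝟏 x) ≡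
          + 1 * ∑ values case-form x + (+ 1 * pred (∑ (map (λ a → pos (v , a)) values) literal) x + + 0)
        combine-eq x rewrite cases-sum values x | ∑-map (λ a → pos (v , a)) values literal x =
          arith₂ (+ length values * (X us σ ⊞ h) x) (𝟏 x) (∑ values (λ a → y (v , a)) x)

      -- Each elimination trades `q` instances of the premise for one instance with a variable less;
      -- when none is left, `X` is 0 and h ≥ 1 remains.
      resolve : 0 ℕ.< q → ∀ us {t} → length us ℕ.≤ d → Unique us →
        (∀ {W} → W₀ ⊑ W → ∀ σ → Derives W t (pred (X us σ ⊞ h))) →
        (Fin n → Fin q) → Derives W₀ (q ℕ.^ length us ℕ.* (t ℕ.+ length us ℕ.* suc stepCost)) (pred h)
      resolve 0<q [] {t} len uniq premise σ = weaken (ℕ.≤-reflexive (sym (trans (ℕ.+-identityʳ _) (ℕ.+-identityʳ t))))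
        (mapExt (λ _ → Has-cong λ x → cong (_+ - 𝟏 x) (ℤ.+-identityˡ (h x))) (premise (λ w → w) σ))
      resolve 0<q (v ∷ us) {t} len (v∉us ∷ uniq) premise σ =
        weaken cost≤ (resolve 0<q us (ℕ.<⇒≤ len) uniq (eliminate (ℕ.<⇒≤ len) v∉us premise) σ)
        where
        e = length us
        r = stepCost
        open ℕ.≤-Reasoning
        instance
          q≢0 : ℕ.NonZero q
          q≢0 = ℕ.>-nonZero 0<q
        -- The summands without a factor `q` are enlarged by one, so that `q` can be pulled out.
        cost≤ : q ℕ.^ e ℕ.* (q ℕ.* suc t ℕ.+ r ℕ.+ e ℕ.* suc r) ℕ.≤ q ℕ.* q ℕ.^ e ℕ.* (t ℕ.+ suc e ℕ.* suc r)
        cost≤ = begin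
          q ℕ.^ e ℕ.* (q ℕ.* suc t ℕ.+ r ℕ.+ e ℕ.* suc r)
              ≤⟨ ℕ.*-monoʳ-≤ (q ℕ.^ e) (ℕ.+-mono-≤ (ℕ.+-monoʳ-≤ (q ℕ.* suc t) (ℕ.m≤n*m r q))
                  (ℕ.m≤n*m (e ℕ.* suc r) q)) ⟩
          q ℕ.^ e ℕ.* (q ℕ.* suc t ℕ.+ q ℕ.* r ℕ.+ q ℕ.* (e ℕ.* suc r))
              ≡⟨ cong (q ℕ.^ e ℕ.*_) (sym (trans (ℕ.*-distribˡ-+ q (suc t ℕ.+ r) (e ℕ.* suc r))
                  (cong (ℕ._+ q ℕ.* (e ℕ.* suc r)) (ℕ.*-distribˡ-+ q (suc t) r)))) ⟩
          q ℕ.^ e ℕ.* (q ℕ.* (suc t ℕ.+ r ℕ.+ e ℕ.* suc r))             ≡⟨ sym (ℕ.*-assoc (q ℕ.^ e) q _) ⟩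
          q ℕ.^ e ℕ.* q ℕ.* (suc t ℕ.+ r ℕ.+ e ℕ.* suc r)
              ≡⟨ cong₂ ℕ._*_ (ℕ.*-comm (q ℕ.^ e) q) (trans (cong (ℕ._+ e ℕ.* suc r) (sym (ℕ.+-suc t r)))
                  (ℕ.+-assoc t (suc r) _)) ⟩
          q ℕ.* q ℕ.^ e ℕ.* (t ℕ.+ suc e ℕ.* suc r)                     ∎

    Sound : ℕ → (Fin m → Fin n → Fin q → ℕ) → (Fin m → ℕ) → Set
    Sound p ℓ β = ∀ j (σ : Fin n → Fin q) →
      foldr (λ u s → (coeff (sys j) u ⊛ σ u) ⊕ s) 0# (support K (sys j)) ≡ rhs (sys j) →
      + p ∣ℤ (+ total (λ u → ℓ j u (σ u)) (support K (sys j)) + - + β j)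

    module System
      (p-1 d : ℕ) (0<q : 0 ℕ.< q)
      (ℓ : Fin m → Fin n → Fin q → ℕ) (β : Fin m → ℕ) (ℓ≤q : ∀ j u a → ℓ j u a ℕ.≤ q)
      (sound : Sound (suc p-1) ℓ β) (narrow : ∀ j → width K (sys j) ℕ.≤ d)
      where

      P : ℤ
      P = + suc p-1

      zAt : Fin m → Fin n → Form V
      zAt j u = ∑ values (λ a x → + ℓ j u a * y (u , a) x)

      z : Fin m → Form V
      z j = ∑ (support K (sys j)) (zAt j)

      open Costs q d public

      values-cost : ∀ c → length values ℕ.* c ≡ q ℕ.* c
      values-cost c = cong (ℕ._* c) (length-allFin′ K q)

      slack : ∀ j u a → + q ≡ + ℓ j u a + + (q ℕ.∸ ℓ j u a)
      slack j u a = cong +_ (sym (ℕ.m+[n∸m]≡n (ℓ≤q j u a)))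

      lower : LowerBounds _≟ᴮ_ (InCNF K sys) z lowerCost
      lower 𝟎∈ 𝟏∈ j = weaken (ℕ.*-monoˡ-≤ (suc (q ℕ.* 3)) (narrow j)) (
        sum-derivable (support K (sys j)) {zAt j} 𝟎∈ λ ρ u → weaken (ℕ.≤-reflexive (values-cost 3)) (
        sum-derivable values {λ a x → + ℓ j u a * y (u , a) x} (ρ 𝟎∈) λ ρ′ a → y≥0 (u , a) >>= λ (ρ″ , y∈) →
        linear (ρ″ (ρ′ (ρ 𝟎∈))) ((ℓ j u a , _ , y∈) ∷ []) λ x → sym (ℤ.+-identityʳ _)))

      upper : UpperBounds _≟ᴮ_ (InCNF K sys) z D upperCost
      upper 𝟎∈ 𝟏∈ j = weaken (ℕ.+-monoˡ-≤ 2 (ℕ.*-monoˡ-≤ (suc (q ℕ.* 4)) (narrow j))) (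
        sum-derivable us {λ u x → + (q ℕ.* q) * 𝟏 x + - zAt j u x} 𝟎∈ at >>= λ (ρ , sum∈) →
        linear (ρ 𝟎∈) ((1 , _ , sum∈) ∷ (D ℕ.∸ length us ℕ.* (q ℕ.* q) , _ , ρ 𝟏∈) ∷ []) eq)
        where
        us = support K (sys j)
        cell : ∀ u {W} → Has W 𝟎 → Has W 𝟏 → ∀ a → Derives W 3 (λ x → + q * 𝟏 x + - (+ ℓ j u a * y (u , a) x))
        cell u 𝟎∈ 𝟏∈ a = y≤1 (u , a) >>= λ (ρ , y∈) →
          linear (ρ 𝟎∈) ((ℓ j u a , _ , y∈) ∷ (q ℕ.∸ ℓ j u a , _ , ρ 𝟏∈) ∷ [])
            λ x → trans (cong (λ b → b * 𝟏 x + - (+ ℓ j u a * y (u , a) x)) (slack j u a))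
                (arith (+ ℓ j u a) (+ (q ℕ.∸ ℓ j u a)) (𝟏 x) (y (u , a) x))
          where
          arith : ∀ l r o y → (l + r) * o + - (l * y) ≡ l * (o + - y) + (r * o + + 0)
          arith = solve-∀
        at : ∀ {W} → _ ⊑ W → ∀ u → Derives W (q ℕ.* 4) (λ x → + (q ℕ.* q) * 𝟏 x + - zAt j u x)
        at ρ u = weaken (ℕ.≤-reflexive (values-cost 4)) (
          mapExt (λ _ → Has-cong λ x → trans (∑-complement values (λ a x → + ℓ j u a * y (u , a) x) q x)
                                             (cong (λ l → + l * 𝟏 x + - zAt j u x) (values-cost q)))
          (sum-derivable values {λ a x → + q * 𝟏 x + - (+ ℓ j u a * y (u , a) x)} (ρ 𝟎∈) λ ρ′ → cell u
              (ρ′ (ρ 𝟎∈)) (ρ′ (ρ 𝟏∈))))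
        total≤D : length us ℕ.* (q ℕ.* q) ℕ.≤ D
        total≤D = ℕ.*-monoˡ-≤ (q ℕ.* q) (narrow j)
        eq : ∀ x → + D * 𝟏 x + - z j x ≡ + 1 * ∑ us (λ u x → + (q ℕ.* q) * 𝟏 x + - zAt j u x) x +
            (+ (D ℕ.∸ length us ℕ.* (q ℕ.* q)) * 𝟏 x + + 0)
        eq x rewrite ∑-complement us (zAt j) (q ℕ.* q) x =
          trans (cong (λ b → + b * 𝟏 x + - z j x) (sym (ℕ.m+[n∸m]≡n total≤D)))
                (arith (+ (length us ℕ.* (q ℕ.* q))) (+ (D ℕ.∸ length us ℕ.* (q ℕ.* q))) (𝟏 x) (z j x))
          where
          arith : ∀ l r o z → (l + r) * o + - z ≡ + 1 * (l * o + - z) + (r * o + + 0)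
          arith = solve-∀

      -- What the term for the value `a` contributes when the variable equals `b`.
      point : (Fin q → ℕ) → Fin q → Fin q → ℕ
      point f b a = if does (a ≟ᶠ b) then f a else 0

      point-on : ∀ f a → point f a a ≡ f a
      point-on f a with a ≟ᶠ a
      ... | yes _ = refl
      ... | no  a≢a = contradiction refl a≢a

      point-off : ∀ f {a b} → a ≢ b → point f b a ≡ 0
      point-off f {a} {b} a≢b with a ≟ᶠ b
      ... | yes a≡b = contradiction a≡b a≢b
      ... | no  _ = refl

      total-point : ∀ f b → total (point f b) values ≡ f b
      total-point f b = trans (foldr-pick ℕ._+_ 0 (λ _ → refl) ℕ.+-identityʳ (allFin′-unique K q) (∈-allFin′ K b)
          (λ a → point-off f)) (point-on f b)

      module Leaf (j : Fin m) where

        us : List (Fin n)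
        us = support K (sys j)

        z⟨_⟩ : (Fin n → Fin q) → ℕ
        z⟨ σ ⟩ = total (λ u → ℓ j u (σ u)) us

        -- Taken with s = 1 and s = -1: the term for `a` deviates from its value under `σ` by at
        -- most `q` times `¬y (u , σ u)`. Summing over `u` and `a` gives ∣ z j - z⟨ σ ⟩ ∣ ≤ q² X.
        cellForm : ℤ → (Fin n → Fin q) → Fin n → Fin q → Form V
        cellForm s σ u a x = + q * ¬y (u , σ u) x + s * (+ point (ℓ j u) (σ u) a * 𝟏 x + - (+ ℓ j u a * y (u , a) x))

        upperCell : ∀ {W} → Has W 𝟎 → ∀ σ u a → Derives W 4 (cellForm (+ 1) σ u a)
        upperCell 𝟎∈ σ u a with a ≟ᶠ σ u
        ... | yes refl = weaken (ℕ.m≤m+n 2 2) (y≤1 (u , a) >>= λ (ρ , y∈) →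
          linear (ρ 𝟎∈) ((q ℕ.+ ℓ j u a , _ , y∈) ∷ []) λ x → arith (+ q) (+ ℓ j u a) (𝟏 x) (y (u , a) x))
          where
          arith : ∀ q l o y → q * (o + - y) + + 1 * (l * o + - (l * y)) ≡ (q + l) * (o + - y) + + 0
          arith = solve-∀
        -- The at-most-one clause says y (u , a) ≤ ¬y (u , σ u); it is taken `ℓ j u a` times and the
        -- coefficient is filled up to `q`.
        ... | no a≢σu = byClause _ (atMostOne u (σ u) a (a≢σu ∘ sym)) >>= λ (ρ , clause∈) →
          y≤1 (u , σ u) >>= λ (ρ′ , y∈) →
          linear (ρ′ (ρ 𝟎∈)) ((ℓ j u a , _ , ρ′ clause∈) ∷ (q ℕ.∸ ℓ j u a , _ , y∈) ∷ []) λ x →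
            trans (cong (λ b → b * ¬y (u , σ u) x + + 1 * (+ 0 * 𝟏 x + - (+ ℓ j u a * y (u , a) x))) (slack j u a))
                  (arith (+ ℓ j u a) (+ (q ℕ.∸ ℓ j u a)) (𝟏 x) (¬y (u , σ u) x) (y (u , a) x))
          where
          arith : ∀ l r o t y → (l + r) * t + + 1 * (+ 0 * o + - (l * y)) ≡ l * (t + (o + - y + + 0) + - o) +
              (r * t + + 0)
          arith = solve-∀

        lowerCell : ∀ {W} → Has W 𝟎 → ∀ σ u a → Derives W 4 (cellForm (- + 1) σ u a)
        lowerCell 𝟎∈ σ u a with a ≟ᶠ σ u
        ... | yes refl = weaken (ℕ.m≤m+n 2 2) (y≤1 (u , a) >>= λ (ρ , y∈) →
          linear (ρ 𝟎∈) ((q ℕ.∸ ℓ j u a , _ , y∈) ∷ []) λ x →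
            trans (cong (λ b → b * ¬y (u , a) x + - + 1 * (+ ℓ j u a * 𝟏 x + - (+ ℓ j u a * y (u , a) x)))
                (slack j u a))
                  (arith (+ ℓ j u a) (+ (q ℕ.∸ ℓ j u a)) (𝟏 x) (y (u , a) x)))
          where
          arith : ∀ l r o y → (l + r) * (o + - y) + - + 1 * (l * o + - (l * y)) ≡ r * (o + - y) + + 0
          arith = solve-∀
        ... | no a≢σu = y≤1 (u , σ u) >>= λ (ρ , ¬y∈) → y≥0 (u , a) >>= λ (ρ′ , y∈) →
          linear (ρ′ (ρ 𝟎∈)) ((q , _ , ρ′ ¬y∈) ∷ (ℓ j u a , _ , y∈) ∷ []) λ x →
            arith (+ q) (+ ℓ j u a) (𝟏 x) (¬y (u , σ u) x) (y (u , a) x)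
          where
          arith : ∀ q l o t y → q * t + - + 1 * (+ 0 * o + - (l * y)) ≡ q * t + (l * y + + 0)
          arith = solve-∀

        deviation : ∀ s σ → (∀ {W} → Has W 𝟎 → ∀ u a → Derives W 4 (cellForm s σ u a)) → ∀ {W} → Has W 𝟎 →
          Derives W (length us ℕ.* suc (q ℕ.* 5)) (λ x → + (q ℕ.* q) * X us σ x + s * (+ z⟨ σ ⟩ * 𝟏 x + - z j x))
        deviation s σ cell 𝟎∈ = mapExt (λ _ → Has-cong (∑-deviation′ s (q ℕ.* q) (λ u → ¬y (u , σ u))
            (λ u → ℓ j u (σ u)) (zAt j) us))
          (sum-derivable us {λ u x → + (q ℕ.* q) * ¬y (u , σ u) x + s * (+ ℓ j u (σ u) * 𝟏 x + - zAt j u x)} 𝟎∈ λ ρ u →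
            weaken (ℕ.≤-reflexive (values-cost 5)) (
            mapExt (λ _ → Has-cong λ x → trans (∑-deviation s q (¬y (u , σ u)) (point (ℓ j u) (σ u))
                (λ a x → + ℓ j u a * y (u , a) x) values x)
              (cong₂ (λ c t → + c * ¬y (u , σ u) x + s * (+ t * 𝟏 x + - zAt j u x)) (values-cost q)
                  (total-point (ℓ j u) (σ u))))
            (sum-derivable values {cellForm s σ u} (ρ 𝟎∈) λ ρ′ a → cell (ρ′ (ρ 𝟎∈)) u a)))

        module _ (v : ℤ) (v≢β : ¬ (P ∣ℤ (v + - + β j))) (h : Form V) where

          Case : Proof → (Fin n → Fin q) → Set
          Case W σ = Derives W baseCost (pred (X us σ ⊞ h))

          -- Under `σ` the form has a value other than `v`, so the deviation bound and the error
          -- bound give q² X + h ≥ ∣ v - z⟨ σ ⟩ ∣ ≥ 1. Adding `X` and `q² h` makes the left side a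
          -- multiple of `X + h`, ready for rounding.
          unequal : ∀ s σ r {W} → (∀ {W} → Has W 𝟎 → ∀ u a → Derives W 4 (cellForm s σ u a)) →
            s * (v + - + z⟨ σ ⟩) ≡ + suc r → Has W 𝟎 → Has W h → Has W (λ x → s * (z j x + - (v * 𝟏 x)) + h x) →
                Case W σ
          unequal s σ r cell v-z 𝟎∈ h∈ side∈ =
            weaken (ℕ.+-mono-≤ (ℕ.*-monoˡ-≤ _ (narrow j))
                (ℕ.+-mono-≤ (ℕ.*-monoˡ-≤ 2 (narrow j)) (ℕ.+-monoˡ-≤ 6 (ℕ.+-monoˡ-≤ 2 (ℕ.*-monoˡ-≤ 2 (narrow j)))))) (
            deviation s σ cell 𝟎∈ >>= λ (ρ₁ , dev∈) →
            X-derivable us σ (ρ₁ 𝟎∈) >>= λ (ρ₂ , X∈) →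
            X⊞h-derivable us σ (ρ₂ (ρ₁ 𝟎∈)) (ρ₂ (ρ₁ h∈)) >>= λ (ρ₃ , Xh∈) →
            linear (ρ₃ (ρ₂ (ρ₁ 𝟎∈))) ((1 , _ , ρ₃ (ρ₂ dev∈)) ∷ (1 , _ , ρ₃ (ρ₂ (ρ₁ side∈))) ∷
                (q ℕ.* q , _ , ρ₃ (ρ₂ (ρ₁ h∈))) ∷ (1 , _ , ρ₃ X∈) ∷ []) eq >>= λ (ρ₄ , sum∈) →
            round (suc (q ℕ.* q)) r (ρ₄ Xh∈) sum∈ λ _ → refl)
            where
            arith : ∀ c X s k z v o h → (+ 1 + c) * (X + h) + - (s * (v + - k) * o) ≡
              + 1 * (c * X + s * (k * o + - z)) + (+ 1 * (s * (z + - (v * o)) + h) + (c * h + (+ 1 * X + + 0)))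
            arith = solve-∀
            eq : ∀ x → + suc (q ℕ.* q) * (X us σ x + h x) + - (+ suc r * 𝟏 x) ≡
              + 1 * (+ (q ℕ.* q) * X us σ x + s * (+ z⟨ σ ⟩ * 𝟏 x + - z j x)) +
              (+ 1 * (s * (z j x + - (v * 𝟏 x)) + h x) + (+ (q ℕ.* q) * h x + (+ 1 * X us σ x + + 0)))
            eq x = trans (cong (λ t → + suc (q ℕ.* q) * (X us σ x + h x) + - (t * 𝟏 x)) (sym v-z))
                         (arith (+ (q ℕ.* q)) (X us σ x) s (+ z⟨ σ ⟩) (z j x) v (𝟏 x) (h x))

          -- The clause of the equation asserts the forced value of `v₀` unless another variable
          -- deviates from `σ`. As `σ v₀` is not the forced value, the at-most-one clause turns
          -- `y (v₀ , forced)` into `¬y (v₀ , σ v₀)`, and the sum is X ≥ 1.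
          falsified : ∀ σ us → support K (sys j) ≡ us →
            foldr (λ u s → (coeff (sys j) u ⊛ σ u) ⊕ s) 0# us ≢ rhs (sys j) →
            ∀ {W} → Has W 𝟎 → Has W h → Derives W 5 (pred (X us σ ⊞ h))
          falsified σ [] eq unsat 𝟎∈ h∈ = weaken (ℕ.m≤m+n 3 2) (
            byClause [] (eqnEmpty j eq (unsat ∘ sym)) >>= λ (ρ , clause∈) →
            linear (ρ 𝟎∈) ((1 , _ , clause∈) ∷ (1 , _ , ρ h∈) ∷ []) λ x → arith (𝟏 x) (h x))
            where
            arith : ∀ o h → + 0 + h + - o ≡ + 1 * (+ 0 + - o) + (+ 1 * h + + 0)
            arith = solve-∀
          falsified σ (v₀ ∷ rest) eq unsat 𝟎∈ h∈ =
            byClause _ (eqnNonEmpty j v₀ rest σ eq) >>= λ (ρ , clause∈) →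
            byClause _ (atMostOne v₀ forced (σ v₀) forced≢) >>= λ (ρ′ , amo∈) →
            linear (ρ′ (ρ 𝟎∈)) ((1 , _ , ρ′ clause∈) ∷ (1 , _ , amo∈) ∷ (1 , _ , ρ′ (ρ h∈)) ∷ []) λ x →
              trans (arith (𝟏 x) (y (v₀ , forced) x) (¬y (v₀ , σ v₀) x) (X rest σ x) (h x))
                    (cong (λ r → + 1 * (y (v₀ , forced) x + r + - 𝟏 x) +
                                 (+ 1 * (¬y (v₀ , forced) x + (¬y (v₀ , σ v₀) x + + 0) + - 𝟏 x) + (+ 1 * h x + + 0)))
                          (sym (∑-map (λ u → neg (u , σ u)) rest literal x)))
            where
            remainder forced : Fin q
            remainder = foldr (λ u s → (coeff (sys j) u ⊛ σ u) ⊕ s) 0# rest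
            forced    = (coeff (sys j) v₀ ⁻¹) ⊛ (rhs (sys j) ⊕ (⊖ remainder))
            forced≢ : forced ≢ σ v₀
            forced≢ forced≡ = unsat (trans (cong (λ a → (coeff (sys j) v₀ ⊛ a) ⊕ remainder) (sym forced≡))
              (LinearAlgebra.solve-for K (rhs (sys j)) remainder
                (All.head (subst (All _) eq (LinearAlgebra.support-nonzero K (sys j))))))
            arith : ∀ o y t r h → t + r + h + - o ≡
              + 1 * (y + r + - o) + (+ 1 * (o + - y + (t + + 0) + - o) + (+ 1 * h + + 0))
            arith = solve-∀

          caseSplit : ∀ {W} σ → Has W 𝟎 → Has W h → Has W (above (z j) v h) → Has W (below (z j) v h) → Case W σ
          caseSplit {W} σ 𝟎∈ h∈ above∈ below∈ with v + - + z⟨ σ ⟩ in eq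
          -- The form takes exactly the value `v` under `σ`; since `v` is incongruent to `β j`,
          -- soundness shows that `σ` violates the equation.
          ... | + zero = weaken (ℕ.≤-trans (ℕ.m≤n+m 5 (d ℕ.* suc (q ℕ.* 5) ℕ.+ (d ℕ.* 2 ℕ.+ (d ℕ.* 2 ℕ.+ 3))))
              (ℕ.≤-reflexive shape))
                           (falsified σ us refl (λ sat → v≢β
                               (subst (λ w → P ∣ℤ (w + - + β j)) (sym (ℤ.i-j≡0⇒i≡j v (+ z⟨ σ ⟩) eq))
                                   (sound j σ sat))) 𝟎∈ h∈)
            where
            shape : d ℕ.* suc (q ℕ.* 5) ℕ.+ (d ℕ.* 2 ℕ.+ (d ℕ.* 2 ℕ.+ 3)) ℕ.+ 5 ≡ baseCost
            shape = trans (ℕ.+-assoc (d ℕ.* suc (q ℕ.* 5)) _ 5) (cong (d ℕ.* suc (q ℕ.* 5) ℕ.+_)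
                      (trans (ℕ.+-assoc (d ℕ.* 2) _ 5) (cong (d ℕ.* 2 ℕ.+_)
                          (trans (ℕ.+-assoc (d ℕ.* 2) 3 5) (sym (ℕ.+-assoc (d ℕ.* 2) 2 6))))))
          ... | + suc r = unequal (+ 1) σ r (λ 𝟎∈ → upperCell 𝟎∈ σ) (trans (ℤ.*-identityˡ _) eq) 𝟎∈ h∈
                            (Has-cong (λ x → cong (_+ h x) (sym (ℤ.*-identityˡ (z j x + - (v * 𝟏 x))))) above∈)
          ... | -[1+ r ] = unequal (- + 1) σ r (λ 𝟎∈ → lowerCell 𝟎∈ σ)
              (trans (cong (- + 1 *_) eq) (ℤ.-1*i≡-i -[1+ r ])) 𝟎∈ h∈
                            (Has-cong (λ x → cong (_+ h x) (arith (z j x) (v * 𝟏 x))) below∈)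
            where
            arith : ∀ z w → - z + w ≡ - + 1 * (z + - w)
            arith = solve-∀

      leaf : Refutations _≟ᴮ_ (InCNF K sys) z P β leafCost
      leaf 𝟎∈ 𝟏∈ j v v≢β h h∈ above∈ below∈ = weaken (ℕ.*-mono-≤ (ℕ.^-monoʳ-≤ q (narrow j))
          (ℕ.+-monoʳ-≤ baseCost (ℕ.*-monoˡ-≤ _ (narrow j)))) (
        Resolution.resolve d 𝟎∈ h∈ 0<q (support K (sys j)) (narrow j) (support-unique K (sys j))
          (λ ρ σ → Leaf.caseSplit j v v≢β h σ (ρ 𝟎∈) (ρ h∈) (ρ above∈) (ρ below∈)) (λ _ → 0#))
        where
        instance
          q≢0 : ℕ.NonZero q
          q≢0 = ℕ.>-nonZero 0<q

  -- Size bounds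

  infix 4 _≲_^_
  record _≲_^_ (x N e : ℕ) : Set where
    constructor below-power
    field
      ≤-power : x ℕ.≤ N ℕ.^ e
  open _≲_^_ public

  module Growth {N : ℕ} (2≤N : 2 ℕ.≤ N) where

    private
      instance
        N≢0 : ℕ.NonZero N
        N≢0 = ℕ.>-nonZero (ℕ.≤-trans (s≤s z≤n) 2≤N)

    constant : ∀ c e → {T (c ℕ.≤ᵇ 2 ℕ.^ e)} → c ≲ N ^ e
    constant c e {c≤2^e} = below-power (ℕ.≤-trans (ℕ.≤ᵇ⇒≤ c (2 ℕ.^ e) c≤2^e) (ℕ.^-monoˡ-≤ e 2≤N))

    raise : ∀ {x e e′} → e ℕ.≤ e′ → x ≲ N ^ e → x ≲ N ^ e′
    raise e≤e′ (below-power x≤) = below-power (ℕ.≤-trans x≤ (ℕ.^-monoʳ-≤ N e≤e′))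

    infixl 7 _⊛_
    _⊛_ : ∀ {x y a b} → x ≲ N ^ a → y ≲ N ^ b → x ℕ.* y ≲ N ^ (a ℕ.+ b)
    _⊛_ {a = a} {b} (below-power x≤) (below-power y≤) =
      below-power (ℕ.≤-trans (ℕ.*-mono-≤ x≤ y≤) (ℕ.≤-reflexive (sym (ℕ.^-distribˡ-+-* N a b))))

    infixl 6 _⊕_
    -- The extra 1 in the exponent pays for the factor 2 of two summands, as N ≥ 2.
    _⊕_ : ∀ {x y a b} → x ≲ N ^ a → y ≲ N ^ b → x ℕ.+ y ≲ N ^ suc (a ℕ.+ b)
    _⊕_ {x} {y} {a} {b} x≲ y≲ = below-power (ℕ.≤-trans
      (ℕ.+-mono-≤ (≤-power (raise (ℕ.m≤m+n a b) x≲)) (ℕ.≤-trans (≤-power (raise (ℕ.m≤n+m b a) y≲)) (ℕ.m≤m+n _ 0)))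
      (ℕ.*-monoˡ-≤ (N ℕ.^ (a ℕ.+ b)) 2≤N))

  ≤2^log : ∀ m → m ℕ.≤ 2 ℕ.^ suc ⌊log₂ m ⌋
  ≤2^log m = ℕ.≮⇒≥ λ lt → ℕ.1+n≰n (subst (ℕ._≤ ⌊log₂ m ⌋) (⌊log₂[2^n]⌋≡n (suc ⌊log₂ m ⌋)) (⌊log₂⌋-mono-≤ (ℕ.<⇒≤ lt)))

  inhabited⇒0< : ∀ {k} → Fin k → 0 ℕ.< k
  inhabited⇒0< {suc _} _ = s≤s z≤n

  distinct⇒2≤ : ∀ {k} (a b : Fin k) → a ≢ b → 2 ℕ.≤ k
  distinct⇒2≤ {1} fzero fzero a≢b = contradiction refl a≢b
  distinct⇒2≤ {suc (suc _)} _ _ _ = s≤s (s≤s z≤n)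

  -- From unsatisfiable linear systems to refutations.

  module FiniteFieldSystem {q n m : ℕ} (K : FiniteField q) (sys : Fin m → Equation q n) where

    open FiniteField K using (0#; 1#; _⁻¹; 0≢1) renaming (_+_ to _⊕_; _*_ to _⊛_; -_ to ⊖_)
    open LinearAlgebra K
      using (p; p-1; p≤q; φ; φ<p; φ0≡0; _~_; φ-~; ~-0; ~-+; ~-unique; 0~⇒p∣; 1~⇒p∤; sum; sum-cong-≗; *-distribʳ-sum;
             *-assoc; zeroˡ; zeroʳ; distribˡ; +-identityʳ; Refuter; sumFin≡sum; sumFin-allFin′; support-nonzero;
                 sum-support; solve-for)
    open Encoding K sys

    refutation : ∀ {s t} → s ℕ.≤ t → Derives (proof []) s (pred 𝟎) → CPRefutation _≟ᴮ_ (InCNF K sys) t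
    refutation {s} s≤t (ext {W} _ short falsum∈) = lines W , derivation W , line falsum∈ ,
      ℕ.≤-trans short (ℕ.≤-trans (ℕ.≤-reflexive (ℕ.+-identityʳ s)) s≤t)

    0<q : 0 ℕ.< q
    0<q = inhabited⇒0< 0#

    2≤q : 2 ℕ.≤ q
    2≤q = distinct⇒2≤ 0# 1# 0≢1

    -- Treated apart because the size bound is 1 when m = 1 and d ≤ 1, which leaves room for a
    -- single line.
    Falsum : Fin m → Set
    Falsum j = support K (sys j) ≡ [] × rhs (sys j) ≢ 0#

    falsum? : Dec (∃ Falsum)
    falsum? = any? λ j → List.≡-dec _≟ᶠ_ (support K (sys j)) [] ×-dec ¬? (rhs (sys j) ≟ᶠ 0#)

    refuteFalsum : ∃ Falsum → Derives (proof []) 1 (pred 𝟎)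
    refuteFalsum (j , empty , rhs≢0) = byClause [] (eqnEmpty j empty rhs≢0)

    sat? : ∀ σ j → Dec (Sat K σ (sys j))
    sat? σ j = _ ≟ᶠ _

    violated : ¬ Satisfiable K sys → ∀ σ → ∃[ j ] ¬ Sat K σ (sys j)
    violated unsat σ = ¬∀⟶∃¬ m (λ j → Sat K σ (sys j)) (sat? σ) λ sat → unsat (σ , sat)

    -- Systems of width at most one, by unit propagation.

    module UnitEquations where

      determines? : ∀ v j → Dec (support K (sys j) ≡ v ∷ [])
      determines? v j = List.≡-dec _≟ᶠ_ (support K (sys j)) (v ∷ [])

      forced : Fin n → Fin m → Fin q
      forced v j = (coeff (sys j) v ⁻¹) ⊛ (rhs (sys j) ⊕ (⊖ 0#))

      propagated : Fin n → Fin q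
      propagated v with any? (determines? v)
      ... | yes (j , _) = forced v j
      ... | no  _       = 0#

      refuteConflict : ∀ v i j → support K (sys i) ≡ v ∷ [] → support K (sys j) ≡ v ∷ [] → forced v i ≢ forced v j →
                       Derives (proof []) 5 (pred 𝟎)
      refuteConflict v i j i-unit j-unit conflict =
        byClause _ (eqnNonEmpty i v [] propagated i-unit) >>= λ (_ , i∈) →
        byClause _ (eqnNonEmpty j v [] propagated j-unit) >>= λ (ρ₁ , j∈) →
        byClause _ (atMostOne v (forced v i) (forced v j) conflict) >>= λ (ρ₂ , ij∈) →
        byComb 1 1 (ρ₂ (ρ₁ i∈)) (ρ₂ j∈) (λ _ → refl) >>= λ (ρ₃ , sum∈) →
        byComb 1 1 sum∈ (ρ₃ ij∈) λ x → arith (𝟏 x) (y (v , forced v i) x) (y (v , forced v j) x)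
        where
        arith : ∀ o a b → + 0 + - o ≡
          + 1 * (+ 1 * (a + + 0 + - o) + + 1 * (b + + 0 + - o)) + + 1 * (o + - a + (o + - b + + 0) + - o)
        arith = solve-∀

      -- The propagated assignment violates an equation in a single variable. Its value there was
      -- dictated by an equation demanding something else, hence by a different one; this gives 2 ≤
      -- m and two clauses in conflict.
      refute : ¬ ∃ Falsum → (∀ j → width K (sys j) ℕ.≤ 1) → ¬ Satisfiable K sys →
               2 ℕ.≤ m × Derives (proof []) 5 (pred 𝟎)
      refute noFalsum narrow unsat with violated unsat propagated
      ... | j , ¬sat = go (support K (sys j)) refl (narrow j)
        where
        unsatisfied : ∀ us → support K (sys j) ≡ us →
          foldr (λ u s → (coeff (sys j) u ⊛ propagated u) ⊕ s) 0# us ≢ rhs (sys j)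
        unsatisfied us refl sat = ¬sat (trans (sum-support (sys j) propagated) sat)
        go : ∀ us → support K (sys j) ≡ us → length us ℕ.≤ 1 → 2 ℕ.≤ m × Derives (proof []) 5 (pred 𝟎)
        go [] empty _ = contradiction (j , empty , unsatisfied [] empty ∘ sym) noFalsum
        go (_ ∷ _ ∷ _) _ (s≤s ())
        go (v ∷ []) unit _ with any? (determines? v) | unsatisfied (v ∷ []) unit
        ... | no  none | _ = contradiction (j , unit) none
        ... | yes (i , i-unit) | differs = distinct⇒2≤ i j (λ { refl → conflict refl }) , refuteConflict v i j
            i-unit unit conflict
          where
          conflict : forced v i ≢ forced v j
          conflict eq = differs (trans (cong (λ a → (coeff (sys j) v ⊛ a) ⊕ 0#) eq)
            (solve-for (rhs (sys j)) 0# (All.head (subst (All _) unit (support-nonzero (sys j))))))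

    -- The integral forms of a combination reading 0 = 1.

    module Main (v₀ : Fin n) (d : ℕ) (narrow : ∀ j → width K (sys j) ℕ.≤ d)
                (refuter : Refuter (λ j u → coeff (sys j) u) (λ j → rhs (sys j))) where

      μ : Fin m → Fin q
      μ = proj₁ refuter

      ℓ : Fin m → Fin n → Fin q → ℕ
      ℓ j u a = φ (μ j ⊛ (coeff (sys j) u ⊛ a))

      β : Fin m → ℕ
      β j = φ (μ j ⊛ rhs (sys j))

      ~-total : ∀ {A : Set} (g : A → Fin q) xs → foldr (λ a s → g a ⊕ s) 0# xs ~ total (φ ∘ g) xs
      ~-total g []       = ~-0
      ~-total g (a ∷ xs) = ~-+ {s = φ (g a)} {t = total (φ ∘ g) xs} (φ-~ (g a)) (~-total g xs)

      ~-total-sum : ∀ {k} (g : Fin k → Fin q) → sum g ~ total (φ ∘ g) (allFin′ K k)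
      ~-total-sum {k} g = subst (_~ total (φ ∘ g) (allFin′ K k)) (trans (sym (sumFin-allFin′ g)) (sumFin≡sum g))
          (~-total g (allFin′ K k))

      -- Multiplied by `μ j`, both sides of the equation are the same field element. Additivity of
      -- `_~_` makes the sum of residues a residue of it, and two residues of one element are
      -- congruent.
      sound : Sound p ℓ β
      sound j σ sat = subst (+ p ∣ℤ_) (trans (cong (λ r → + s + r + - (+ p * + β j)) (ℤ.pos-* p-1 (β j)))
          (arith (+ s) (+ p-1) (+ β j)))
        (ℤ∣.∣m∣n⇒∣m+n (ℤ∣.∣ᵤ⇒∣ {+ p} {+ (s ℕ.+ p-1 ℕ.* β j)}
            (~-unique {s = s} {t = β j} (subst (_~ s) scaled (~-total (λ u → μ j ⊛ (coeff (sys j) u ⊛ σ u)) us))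
                (φ-~ _)))
                      (ℤ∣.∣m⇒∣-m (ℤ∣.divides (+ β j) (ℤ.*-comm (+ p) (+ β j)))))
        where
        us = support K (sys j)
        s = total (λ u → ℓ j u (σ u)) us
        arith : ∀ s r b → s + r * b + - ((+ 1 + r) * b) ≡ s + - b
        arith = solve-∀
        distribute : ∀ us → foldr (λ u s → (μ j ⊛ (coeff (sys j) u ⊛ σ u)) ⊕ s) 0# us ≡
                            μ j ⊛ foldr (λ u s → (coeff (sys j) u ⊛ σ u) ⊕ s) 0# us
        distribute []       = sym (zeroʳ (μ j))
        distribute (u ∷ us) = trans (cong ((μ j ⊛ (coeff (sys j) u ⊛ σ u)) ⊕_) (distribute us)) (sym (distribˡ _ _ _))
        scaled : foldr (λ u s → (μ j ⊛ (coeff (sys j) u ⊛ σ u)) ⊕ s) 0# us ≡ μ j ⊛ rhs (sys j)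
        scaled = trans (distribute us) (cong (μ j ⊛_) sat)

      ℓ≤q : ∀ j u a → ℓ j u a ℕ.≤ q
      ℓ≤q j u a = ℕ.≤-trans (ℕ.<⇒≤ (φ<p (μ j ⊛ (coeff (sys j) u ⊛ a)))) p≤q

      open System p-1 d 0<q ℓ β ℓ≤q sound narrow

      indicator-same : ∀ v → indicator (_≟ᴮ_ {n} {q}) v v ≡ + 1
      indicator-same v with v ≟ᴮ v
      ... | yes _ = refl
      ... | no v≢v = contradiction refl v≢v

      indicator-diff : ∀ {v w} → v ≢ w → indicator (_≟ᴮ_ {n} {q}) v w ≡ + 0
      indicator-diff {v} {w} v≢w with v ≟ᴮ w
      ... | yes v≡w = contradiction v≡w v≢w
      ... | no _ = refl

      zAt-coefficient : ∀ j u a → zAt j u (just (u , a)) ≡ + ℓ j u a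
      zAt-coefficient j u a = trans
        (foldr-pick _+_ (+ 0) ℤ.+-identityˡ ℤ.+-identityʳ {g = λ b → + ℓ j u b * indicator _≟ᴮ_ (u , b) (u , a)}
            (allFin′-unique K q) (∈-allFin′ K a)
          λ b b≢a → trans (cong (+ ℓ j u b *_) (indicator-diff (b≢a ∘ cong proj₂))) (ℤ.*-zeroʳ (+ ℓ j u b)))
        (trans (cong (+ ℓ j u a *_) (indicator-same (u , a))) (ℤ.*-identityʳ (+ ℓ j u a)))

      zAt-other : ∀ j {u w} a → u ≢ w → zAt j u (just (w , a)) ≡ + 0
      zAt-other j {u} {w} a u≢w = foldr-zero _+_ (+ 0) ℤ.+-identityˡ
          {g = λ b → + ℓ j u b * indicator _≟ᴮ_ (u , b) (w , a)}
        (All.universal (λ b → trans (cong (+ ℓ j u b *_) (indicator-diff (u≢w ∘ cong proj₁)))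
            (ℤ.*-zeroʳ (+ ℓ j u b))) values)

      -- Outside the support no term contains `u`; the formula persists there because `φ 0#` is 0.
      z-coefficient : ∀ j u a → z j (just (u , a)) ≡ + ℓ j u a
      z-coefficient j u a with coeff (sys j) u ≟ᶠ 0#
      ... | no  cu≢0 = trans (foldr-pick _+_ (+ 0) ℤ.+-identityˡ ℤ.+-identityʳ {g = λ w → zAt j w (just (u , a))}
          (support-unique K (sys j))
                         (∈-filter⁺ (λ w → ¬? (coeff (sys j) w ≟ᶠ 0#)) (∈-allFin′ K u) cu≢0)
                             (λ w → zAt-other j a)) (zAt-coefficient j u a)
      ... | yes cu≡0 = trans (foldr-zero _+_ (+ 0) ℤ.+-identityˡ {g = λ w → zAt j w (just (u , a))}
                         (All.map (λ cw≢0 → zAt-other j a λ { refl → cw≢0 cu≡0 }) (support-nonzero (sys j))))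
                         (cong +_ (sym (trans (cong φ (trans (cong (λ c → μ j ⊛ (c ⊛ a)) cu≡0)
                             (trans (cong (μ j ⊛_) (zeroˡ a)) (zeroʳ (μ j))))) φ0≡0)))

      z-constant : ∀ j → z j nothing ≡ + 0
      z-constant j = foldr-zero _+_ (+ 0) ℤ.+-identityˡ {g = λ u → zAt j u nothing} (All.universal (λ u →
        foldr-zero _+_ (+ 0) ℤ.+-identityˡ {g = λ a → + ℓ j u a * + 0}
            (All.universal (λ a → ℤ.*-zeroʳ (+ ℓ j u a)) values)) (support K (sys j)))

      equations : List (Fin m)
      equations = allFin′ K m

      -- The refuter cancels the column of `u`, also after multiplication by `a`, and every residue
      -- of `0#` is divisible by `p`.
      p∣coefficient : ∀ u a → p ℕ∣.∣ total (λ j → ℓ j u a) equations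
      p∣coefficient u a = 0~⇒p∣ {total (λ j → ℓ j u a) equations}
          (subst (_~ total (λ j → ℓ j u a) equations) vanishes (~-total-sum (λ j → μ j ⊛ (coeff (sys j) u ⊛ a))))
        where
        vanishes : sum (λ j → μ j ⊛ (coeff (sys j) u ⊛ a)) ≡ 0#
        vanishes = trans (sum-cong-≗ λ j → sym (*-assoc (μ j) (coeff (sys j) u) a))
          (trans (sym (*-distribʳ-sum a (λ j → μ j ⊛ coeff (sys j) u)))
              (trans (cong (_⊛ a) (proj₁ (proj₂ refuter) u)) (zeroˡ a)))

      ζ : Form V
      ζ nothing        = + 0
      ζ (just (u , a)) = + ℕ∣.quotient (p∣coefficient u a)

      z-total : ∀ x → ∑ equations z x ≡ P * ζ x
      z-total nothing = trans (foldr-zero _+_ (+ 0) ℤ.+-identityˡ {g = λ j → z j nothing}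
          (All.universal z-constant equations)) (sym (ℤ.*-zeroʳ P))
      z-total (just (u , a)) = begin
        ∑ equations z (just (u , a))                    ≡⟨ coefficients equations ⟩
        + total (λ j → ℓ j u a) equations               ≡⟨ cong +_ (ℕ∣._∣_.equality (p∣coefficient u a)) ⟩
        + (ℕ∣.quotient (p∣coefficient u a) ℕ.* p)       ≡⟨ ℤ.pos-* (ℕ∣.quotient (p∣coefficient u a)) p ⟩
        + ℕ∣.quotient (p∣coefficient u a) * P           ≡⟨ ℤ.*-comm _ P ⟩
        P * ζ (just (u , a))                            ∎
        where
        open ≡-Reasoning
        coefficients : ∀ js → ∑ js z (just (u , a)) ≡ + total (λ j → ℓ j u a) js
        coefficients []       = refl
        coefficients (j ∷ js) = cong₂ _+_ (z-coefficient j u a) (coefficients js)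

      -- The right-hand sides combine to `1#`, which is not in `H` and so has no residue divisible
      -- by `p`.
      p∤β : ¬ (P ∣ℤ (+ total β equations))
      p∤β P∣ = 1~⇒p∤ {total β equations} (subst (_~ total β equations) (proj₂ (proj₂ refuter))
          (~-total-sum (λ j → μ j ⊛ rhs (sys j)))) (ℤ∣.∣⇒∣ᵤ P∣)

      module DC = DivideAndConquer (_≟ᴮ_ {n} {q}) (InCNF K sys) z β p-1 D lowerCost upperCost leafCost m lower
          upper leaf

      refute : Derives (proof []) (4 ℕ.+ DC.rootCost (suc ⌊log₂ m ⌋)) (pred 𝟎)
      -- The bounds of one Boolean variable supply the basic lines: their zero multiple is 0 ≥ 0 and
      -- their sum is 1 ≥ 0.
      refute = y≥0 (v₀ , 0#) >>= λ (_ , y∈) →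
        y≤1 (v₀ , 0#) >>= λ (ρ₁ , ¬y∈) →
        byComb 0 0 ¬y∈ ¬y∈ (λ _ → refl) >>= λ (ρ₂ , 𝟎∈) →
        byComb 1 1 (ρ₂ (ρ₁ y∈)) (ρ₂ ¬y∈) (λ x → arith (y (v₀ , 0#) x) (𝟏 x)) >>= λ (ρ₃ , 𝟏∈) →
        DC.refuteAll (suc ⌊log₂ m ⌋) equations (subst (ℕ._≤ 2 ℕ.^ suc ⌊log₂ m ⌋) (sym (length-allFin′ K m)) (≤2^log m))
          (ℕ.≤-reflexive (length-allFin′ K m)) (ρ₃ 𝟎∈) 𝟏∈ ζ z-total p∤β
        where
        arith : ∀ y o → o ≡ + 1 * y + + 1 * (o + - y)
        arith = solve-∀

-- Exponents of the size bound.

module Size {q m d N : ℕ} (2≤N : 2 ℕ.≤ N) (m≤N : m ℕ.≤ N) (q≤N : q ℕ.≤ N) (d≤N : d ℕ.≤ N)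
    (q^d≤N² : q ℕ.^ d ℕ.≤ N ℕ.^ 2) where

  open Growth 2≤N

  open Costs q d

  open DivideAndConquerCosts D lowerCost upperCost leafCost m

  ≲-base : ∀ {x} → x ℕ.≤ N → x ≲ N ^ 1
  ≲-base x≤N = below-power (ℕ.≤-trans x≤N (ℕ.≤-reflexive (sym (ℕ.^-identityʳ N))))

  m≲ : m ≲ N ^ 1
  m≲ = ≲-base m≤N
  q≲ : q ≲ N ^ 1
  q≲ = ≲-base q≤N
  d≲ : d ≲ N ^ 1
  d≲ = ≲-base d≤N

  one : 1 ≲ N ^ 0
  one = constant 1 0

  leafCost≲ : leafCost ≲ N ^ 29
  leafCost≲ = below-power {e = 2} q^d≤N² ⊛
    ((d≲ ⊛ (one ⊕ q≲ ⊛ constant 5 3) ⊕ (d≲ ⊛ constant 2 1 ⊕ ((d≲ ⊛ constant 2 1 ⊕ constant 2 1) ⊕ constant 6 3)))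
      ⊕ d≲ ⊛ (one ⊕ (d≲ ⊛ constant 2 1 ⊕ constant 7 3)))

  boundsCost≲ : boundsCost ≲ N ^ 17
  boundsCost≲ = m≲ ⊛ (one ⊕ d≲ ⊛ (one ⊕ q≲ ⊛ constant 3 2))
    ⊕ m≲ ⊛ (one ⊕ (d≲ ⊛ (one ⊕ q≲ ⊛ constant 4 2) ⊕ constant 2 1))

  sweepLength≲ : sweepLength ≲ N ^ 5
  sweepLength≲ = one ⊕ m≲ ⊛ (d≲ ⊛ (q≲ ⊛ q≲))

  -- A level contributes 17 for the bounds, 5 for the sweep, 3 and 2 for the constants and 1 for
  -- each of three additions, in all 30. At level zero the 29 of a leaf grow to 31 by adding the
  -- constant 2.
  cost≲ : ∀ k → cost k ≲ N ^ (31 ℕ.+ 30 ℕ.* k)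
  cost≲ zero    = leafCost≲ ⊕ constant 2 1
  cost≲ (suc k) = subst (cost (suc k) ≲ N ^_) (exponent k)
    (boundsCost≲ ⊕ (sweepLength≲ ⊛ (cost≲ k ⊕ constant 6 3) ⊕ constant 4 2))
    where
    exponent : ∀ k → suc (17 ℕ.+ suc (5 ℕ.+ suc (31 ℕ.+ 30 ℕ.* k ℕ.+ 3) ℕ.+ 2)) ≡ 31 ℕ.+ 30 ℕ.* suc k
    exponent = ℕSolver.solve-∀

  rootCost≤ : ∀ k → 4 ℕ.+ rootCost (suc k) ℕ.≤ N ℕ.^ (100 ℕ.* suc k)
  -- The exponent obtained is `96 + 30 k`; the summand `4 + 70 k` pads it to a multiple of `suc k`.
  rootCost≤ k = ≤-power (raise (ℕ.≤-trans (ℕ.m≤m+n _ (4 ℕ.+ 70 ℕ.* k)) (ℕ.≤-reflexive (exponent k)))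
    (constant 4 2 ⊕ (boundsCost≲ ⊕ (constant 3 2 ⊕ (sweepLength≲ ⊛ (cost≲ (suc k) ⊕ constant 4 2) ⊕ constant 4 2)))))
    where
    exponent : ∀ k → suc (2 ℕ.+ suc (17 ℕ.+ suc (2 ℕ.+ suc (5 ℕ.+ suc (31 ℕ.+ 30 ℕ.* suc k ℕ.+ 2) ℕ.+ 2)))) ℕ.+
        (4 ℕ.+ 70 ℕ.* k)
                   ≡ 100 ℕ.* suc k
    exponent = ℕSolver.solve-∀

n<2^n : ∀ n → n ℕ.< 2 ℕ.^ n
n<2^n zero    = s≤s z≤n
n<2^n (suc n) = ℕ.≤-trans (ℕ.+-mono-≤ (ℕ.m^n>0 2 n) (n<2^n n))
    (ℕ.≤-reflexive (cong (2 ℕ.^ n ℕ.+_) (sym (ℕ.+-identityʳ _))))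

-- For d ≤ 1 the size of the formula is just `m`, so the five lines are absorbed by a power of m ≥
-- 2, already by the cube.
unitBound : ∀ m k → 2 ≤ m → 5 ≤ (m ℕ.* 1) ^ (100 ℕ.* suc k)
unitBound m k 2≤m = ≤-power (Growth.raise {m ℕ.* 1} 2≤m*1 (ℕ.≤-trans (ℕ.m≤m+n 3 97) (ℕ.m≤m*n 100 (suc k)))
    (Growth.constant 2≤m*1 5 3))
  where
  2≤m*1 : 2 ≤ m ℕ.* 1
  2≤m*1 = ℕ.≤-trans 2≤m (ℕ.≤-reflexive (sym (ℕ.*-identityʳ m)))

-- Assembly of the cases according to the width.

open import Data.Nat using (_*_)

theorem1p3 : ∃[ c ] (∀ (q : ℕ) (K : FiniteField q) (n m d : ℕ) (sys : Fin m → Equation q n)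
    → (∀ j → width K (sys j) ≤ d)
    → ¬ Satisfiable K sys
    → CPRefutation _≟ᴮ_ (InCNF K sys) (sizeF K m d ^ (c * suc ⌊log₂ m ⌋)))
theorem1p3 = 100 , prove
  where
  prove : ∀ (q : ℕ) (K : FiniteField q) (n m d : ℕ) (sys : Fin m → Equation q n)
    → (∀ j → width K (sys j) ≤ d)
    → ¬ Satisfiable K sys
    → CPRefutation _≟ᴮ_ (InCNF K sys) (sizeF K m d ^ (100 * suc ⌊log₂ m ⌋))
  prove q K n m d sys narrow unsat with FiniteFieldSystem.falsum? K sys
  ... | yes falsum@(j , _) = refutation (ℕ.m^n>0 (sizeF K m d) {{ℕ.>-nonZero size>0}} (100 * suc ⌊log₂ m ⌋))
      (refuteFalsum falsum)
    where
    open FiniteFieldSystem K sys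
    size>0 : 0 ℕ.< sizeF K m d
    size>0 = ℕ.*-mono-≤ (inhabited⇒0< j) (ℕ.m^n>0 q {{ℕ.>-nonZero 0<q}} (d ∸ 1))
  -- Truncated subtraction makes `d ∸ 1` zero for d = 0 as for d = 1, so both cases have size `m`.
  prove q K n m 0 sys narrow unsat | no noFalsum with FiniteFieldSystem.UnitEquations.refute K sys noFalsum
      (λ j → ℕ.≤-trans (narrow j) z≤n) unsat
  ... | 2≤m , derivation = FiniteFieldSystem.refutation K sys (unitBound m ⌊log₂ m ⌋ 2≤m) derivation
  prove q K n m 1 sys narrow unsat | no noFalsum with FiniteFieldSystem.UnitEquations.refute K sys noFalsum narrow unsat
  ... | 2≤m , derivation = FiniteFieldSystem.refutation K sys (unitBound m ⌊log₂ m ⌋ 2≤m) derivation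
  -- Without variables each equation reads 0 = b, and none with nonzero b is present.
  prove q K zero m (suc (suc _)) sys narrow unsat | no noFalsum = contradiction ((λ ()) , trivially) unsat
    where
    open FiniteField K using (0#)
    trivially : ∀ j → Sat K (λ ()) (sys j)
    trivially j = sym (decidable-stable (rhs (sys j) ≟ᶠ 0#) λ rhs≢0 → noFalsum (j , refl , rhs≢0))
  prove q K (suc n) m (suc (suc d)) sys narrow unsat | no noFalsum
    with LinearAlgebra.fredholm K (suc n) (λ j → coeff (sys j)) (λ j → rhs (sys j))
  ... | inj₁ (σ , sat) = contradiction (σ , λ j → trans
      (LinearAlgebra.sumFin≡sum K (λ u → FiniteField._*_ K (coeff (sys j) u) (σ u))) (sat j)) unsat
  ... | inj₂ refuter = refutation (Size.rootCost≤ 2≤N m≤N q≤N d≤N q^d≤N² ⌊log₂ m ⌋)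
      (Main.refute fzero (suc (suc d)) narrow refuter)
    where
    open FiniteFieldSystem K sys
    open FiniteField K using (0#)
    -- The width bound is at least 2, so the exponent in `Q` is positive and `N` dominates `q` as
    -- well as `m`. It also dominates the width bound, because q ≥ 2, and its square dominates one
    -- factor `q` more than `Q`.
    N Q : ℕ
    Q = q ^ suc d
    N = m * Q
    instance
      m≢0 : ℕ.NonZero m
      m≢0 = ℕ.>-nonZero (inhabited⇒0< (proj₁ (violated unsat λ _ → 0#)))
      q≢0 : ℕ.NonZero q
      q≢0 = ℕ.>-nonZero 0<q
      Q≢0 : ℕ.NonZero Q
      Q≢0 = ℕ.>-nonZero (ℕ.m^n>0 q (suc d))
    Q≤N : Q ≤ N
    Q≤N = ℕ.m≤n*m Q m
    m≤N : m ≤ N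
    m≤N = ℕ.m≤m*n m Q
    q≤N : q ≤ N
    q≤N = ℕ.≤-trans (ℕ.m≤m*n q (q ^ d) {{ℕ.>-nonZero (ℕ.m^n>0 q d)}}) Q≤N
    2≤N : 2 ≤ N
    2≤N = ℕ.≤-trans 2≤q q≤N
    d≤N : suc (suc d) ≤ N
    d≤N = ℕ.≤-trans (n<2^n (suc d)) (ℕ.≤-trans (ℕ.^-monoˡ-≤ (suc d) 2≤q) Q≤N)
    q^d≤N² : q ^ suc (suc d) ≤ N ^ 2
    q^d≤N² = ℕ.*-mono-≤ q≤N (ℕ.≤-trans Q≤N (ℕ.≤-reflexive (sym (ℕ.*-identityʳ N))))
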